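{- Fix an integer $r\ge2$ and let \[ P_r(x;t)=t^r(1-t)^r-x\,\frac{(1-t)^{r+1}-t^{r+1}}{1-2t}, \] a polynomial in $t$. Let $t_1(x),\dots,t_r(x)$ be the ``small'' zeroes of $P_r(x;t)$ in $t$, i.e. those zeroes (Puiseux series in $x$) with $\lim_{x\to0}t(x)=0$. Then \[ \sum_{k\ge1}\mathsf{tr}(k,r)\,x^k=-\frac12\sum_{i=1}^r\frac{t_i(x)^r(1-t_i(x))^r(1-2t_i(x))^2}{\big(\tfrac{d}{dt}P_r\big)(x;t_i(x))}. \]
   Context: For integers $k\ge 3$, $r\ge 1$, let $\mathrm{SC}(k,r)$ be a convex $k$-gon in the plane each of whose sides is subdivided by $r-1$ additional points lying on that side. A triangulation of a finite planar point set is a maximal dissection of its convex hull into triangles by non-crossing segments between points of the set (no point lying in the interior of a triangle side). For $k\ge3$, $\mathsf{tr}(k,r)$ is the number of triangulations of $\mathrm{SC}(k,r)$. For all $k\ge1$ (in particular $k\in\{1,2\}$), $\mathsf{tr}(k,r)$ is taken to be given by $-\frac{1}{4\pi i}\int_{\mathcal C}\frac{((1-t)^{r+1}-t^{r+1})^k\,dt}{t^{rk}(1-t)^{rk}(1-2t)^{k-2}}$ with $\mathcal C$ a small positively oriented contour around $0$ (this agrees with the triangulation count for $k\ge3$). There are exactly $r$ small zeroes, of the form $t(\omega^i x^{1/r})$, $\omega=e^{2\pi i/r}$, for a power series $t(X)$ with $t(0)=0$. -}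

module Defs where

open import Level using (Level; _⊔_)
open import Algebra.Bundles using (CommutativeRing)
open import Data.Nat as ℕ using (ℕ; zero; suc; _∸_)
open import Data.Fin as F using (Fin)
open import Data.List using (List; []; _∷_; map)
open import Data.Integer as ℤ using (ℤ; +_; -[1+_])
open import Data.Rational as ℚ using (ℚ; ½; 1ℚ)
open import Data.Rational.Properties using (+-*-commutativeRing)

ℚring : CommutativeRing _ _
ℚring = +-*-commutativeRing

module PowerSeries {c ℓ : Level} (R : CommutativeRing c ℓ) where
  open CommutativeRing R using (Carrier; _≈_; _+_; _*_; -_; 0#; 1#)

  PS : Set c
  PS = ℕ → Carrier

  _≈PS_ : PS → PS → Set ℓ
  f ≈PS g = ∀ n → f n ≈ g n

  _^ᶜ_ : Carrier → ℕ → Carrier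
  a ^ᶜ zero = 1#
  a ^ᶜ suc n = a * (a ^ᶜ n)

  natᶜ : ℕ → Carrier
  natᶜ zero = 0#
  natᶜ (suc n) = 1# + natᶜ n

  sumUpTo : ℕ → (ℕ → Carrier) → Carrier
  sumUpTo zero f = 0#
  sumUpTo (suc n) f = sumUpTo n f + f n

  const : Carrier → PS
  const a zero = a
  const a (suc n) = 0#

  𝟘 𝟙 X : PS
  𝟘 = const 0#
  𝟙 = const 1#
  X zero = 0#
  X (suc zero) = 1#
  X (suc (suc n)) = 0#

  _⊕_ : PS → PS → PS
  (f ⊕ g) n = f n + g n

  ⊖_ : PS → PS
  (⊖ f) n = - (f n)

  _⊝_ : PS → PS → PS
  f ⊝ g = f ⊕ (⊖ g)

  _·_ : Carrier → PS → PS
  (a · f) n = a * f n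

  _⊛_ : PS → PS → PS
  (f ⊛ g) n = sumUpTo (suc n) (λ i → f i * g (n ∸ i))

  _^^_ : PS → ℕ → PS
  f ^^ zero = 𝟙
  f ^^ suc k = f ⊛ (f ^^ k)

  sumFin : ∀ {m} → (Fin m → PS) → PS
  sumFin {zero} f = 𝟘
  sumFin {suc m} f = f F.zero ⊕ sumFin (λ i → f (F.suc i))

  lin : Carrier → PS
  lin a zero = 1#
  lin a (suc zero) = - a
  lin a (suc (suc n)) = 0#

  geom : Carrier → PS
  geom a n = a ^ᶜ n

  linPowℤ : Carrier → ℤ → PS
  linPowℤ a (+ m) = lin a ^^ m
  linPowℤ a -[1+ m ] = geom a ^^ suc m

  -- Polynomials in t with coefficients in PS (lists, lowest degree first)

  Poly : Set c
  Poly = List PS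

  _+P_ : Poly → Poly → Poly
  [] +P q = q
  (a ∷ p) +P [] = a ∷ p
  (a ∷ p) +P (b ∷ q) = (a ⊕ b) ∷ (p +P q)

  scaleP : PS → Poly → Poly
  scaleP a q = map (a ⊛_) q

  _*P_ : Poly → Poly → Poly
  [] *P q = []
  (a ∷ p) *P q = scaleP a q +P (𝟘 ∷ (p *P q))

  negP : Poly → Poly
  negP = map ⊖_

  _-P_ : Poly → Poly → Poly
  p -P q = p +P negP q

  constP : PS → Poly
  constP a = a ∷ []

  oneP tP : Poly
  oneP = constP 𝟙
  tP = 𝟘 ∷ 𝟙 ∷ []

  _^P_ : Poly → ℕ → Poly
  p ^P zero = oneP
  p ^P suc k = p *P (p ^P k)

  sumPUpTo : ℕ → (ℕ → Poly) → Poly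
  sumPUpTo zero f = []
  sumPUpTo (suc n) f = sumPUpTo n f +P f n

  evalP : Poly → PS → PS
  evalP [] s = 𝟘
  evalP (a ∷ p) s = a ⊕ (s ⊛ evalP p s)

  derivAux : ℕ → Poly → Poly
  derivAux k [] = []
  derivAux k (b ∷ q) = (natᶜ k · b) ∷ derivAux (suc k) q

  derivP : Poly → Poly
  derivP [] = []
  derivP (a ∷ p) = derivAux 1 p

  -- The polynomial P_r(x;t) = t^r (1-t)^r - x ((1-t)^{r+1} - t^{r+1})/(1-2t),
  -- where the quotient is the polynomial Σ_{j=0}^{r} (1-t)^j t^{r-j}.

  oneMinusT : Poly
  oneMinusT = oneP -P tP

  Qpoly : ℕ → Poly
  Qpoly r = sumPUpTo (suc r) (λ j → (oneMinusT ^P j) *P (tP ^P (r ∸ j)))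

  Ppoly : ℕ → PS → Poly
  Ppoly r x = ((tP ^P r) *P (oneMinusT ^P r)) -P (constP x *P Qpoly r)

  two : Carrier
  two = 1# + 1#

  numer : ℕ → PS → PS
  numer r s = ((s ^^ r) ⊛ ((𝟙 ⊝ s) ^^ r)) ⊛ ((𝟙 ⊝ (two · s)) ^^ 2)

  -- Puiseux series in x with denominator r are power series in X with
  -- x = X^r.  A small zero of P_r(x;t): s(0) = 0 and P_r(X^r; s(X)) = 0.
  xSer : ℕ → PS
  xSer r = X ^^ r

  IsSmallZero : ℕ → PS → Set ℓ
  IsSmallZero r s = (s 0 ≈ 0#) × (evalP (Ppoly r (xSer r)) s ≈PS 𝟘)
    where open import Data.Product using (_×_)

-- tr(k,r) := -(1/4πi) ∮ ((1-t)^{r+1}-t^{r+1})^k / (t^{rk} (1-t)^{rk} (1-2t)^{k-2}) dt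
--          = -(1/2) · [t^{rk-1}] ((1-t)^{r+1}-t^{r+1})^k (1-t)^{-rk} (1-2t)^{2-k}.

module Qser = PowerSeries ℚring

trNumer : ℕ → Qser.PS
trNumer r = (Qser.lin 1ℚ Qser.^^ suc r) Qser.⊝ (Qser.X Qser.^^ suc r)

trIntegrand : ℕ → ℕ → Qser.PS
trIntegrand k r =
  ((trNumer r Qser.^^ k) Qser.⊛ (Qser.geom 1ℚ Qser.^^ (r ℕ.* k)))
    Qser.⊛ Qser.linPowℤ (1ℚ ℚ.+ 1ℚ) ((+ 2) ℤ.- (+ k))

tr : ℕ → ℕ → ℚ
tr k r = ℚ.- (½ ℚ.* trIntegrand k r (r ℕ.* k ∸ 1))

-- Σ_{k ≥ 1} φ(tr(k,r)) x^k  with x = X^r, as a power series in X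
-- (coefficient of X^n only involves k ≤ n since r ≥ 1).

module _ {c ℓ : Level} (K : CommutativeRing c ℓ) where
  open CommutativeRing K using (Carrier; _*_)
  open PowerSeries K

  trGF : (ℚ → Carrier) → ℕ → PS
  trGF φ r n = sumUpTo n (λ k → φ (tr (suc k) r) * ((xSer r ^^ suc k) n))

{-# OPTIONS --safe #-}
-- A small zero s of P_r(X^r; t) satisfies s^r (1−s)^r = X^r Q(s), Q the cofactor of x in −P_r.
-- Applying the Euler operator θ = X d/dX to P_r(X^r; s) = 0 gives θs · P_r′(s) = r X^r Q(s), so
-- the i-th summand of the right-hand side is q_i = (1/r) θt_i (1−2t_i)². Its coefficient at
-- X^{rk} is a residue; the substitution t = s(X) turns it into the residue defining tr(k,r),
-- since (1−2s)² is the k-th integrand at s times (s/X)^{rk}. At exponents n not divisible by r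
-- the q_i cancel: s is determined by its leading coefficient, an r-th root of unity, so that
-- t_i(X) = t_0(d_i X) with d_i running over all r-th roots of unity, and Σ d_i^n = 0.
module Submission where

open import Defs
open import Level using (Level; _⊔_)
open import Algebra.Bundles using (CommutativeRing; RawRing)
open import Algebra.Morphism.Structures using (IsRingHomomorphism)
open import Algebra.Solver.Ring.AlmostCommutativeRing
  using (fromCommutativeRing; _-Raw-AlmostCommutative⟶_)
open import Data.Empty using (⊥-elim)
open import Data.Fin as Fin using (Fin)
import Data.Fin.Properties as Fin
open import Data.Integer as ℤ using (+_)
open import Data.List using ([]; _∷_; map)
open import Data.List.Relation.Unary.All using (All; []; _∷_)
open import Data.Maybe using (Maybe; just; nothing)
open import Data.Nat as ℕ using (ℕ; zero; suc; _≤_; _<_; _∸_; z≤n; s≤s)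
import Data.Nat.DivMod as ℕ
import Data.Nat.Properties as ℕ
open import Data.Product using (Σ; _×_; _,_; proj₁; proj₂)
open import Data.Rational as ℚ using (ℚ; ½; 1ℚ)
import Data.Rational.Properties as ℚ
open import Data.Sum using (_⊎_; inj₁; inj₂)
open import Function using (_∘_)
open import Relation.Binary.PropositionalEquality as ≡ using (_≡_)
open import Relation.Nullary using (¬_; yes; no)

-- Laurent series are avoided throughout. With s = X v, the series v is a unit with inverse u = X/s,
-- and the residue of F(s) s^(-N) ds is read off as the coefficient of X^(N-1) in F(s) u^N ds/dX.
-- Its invariance under substitution rests on a derivative having no X^(-1) term; dividing by the
-- exponent there is legitimate because φ carries 1/n into K. The varying power (1-2t)^(2-k) in the
-- integrand is harmless: (1-t)^(r+1) - t^(r+1) contains the factor 1-2t, so its k-th power leaves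
-- (1-2t)^2 for every k. No zero is constructed and no primitive root of unity is chosen. The
-- hypothesis supplies r distinct series; a uniqueness argument of Hensel type, in which r
-- v(0)^(r-1) has to be regular, makes their leading coefficients r distinct solutions of y^r = 1.
-- That the n-th powers of these sum to 0 when r does not divide n is then obtained by counting the
-- roots of a polynomial, which is where the absence of zero divisors enters.

-- The library's ring solver with coefficients in ℤ, encoded as formal
-- differences (a , b) = a − b, for a commutative ring without decidable equality.
module IntegerSolver {c ℓ} (R : CommutativeRing c ℓ) where
  open CommutativeRing R
  open import Algebra.Properties.Ring ring using (-‿distribˡ-*; -‿distribʳ-*; -0#≈0#)
  open import Algebra.Properties.AbelianGroup +-abelianGroup using (⁻¹-∙-comm; ⁻¹-involutive)
  open import Algebra.Properties.CommutativeSemigroup +-commutativeSemigroup using (interchange)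
  open import Algebra.Properties.Semiring.Mult.TCOptimised semiring
    using (×-homo-+; ×1-homo-*) renaming (_×_ to _×ᵣ_)
  open import Relation.Binary.Reasoning.Setoid setoid

  private
    -- Keeps one component zero, so that a nonnegative coefficient stays in the clause of `value`
    -- without a subtraction.
    reduce : ℕ × ℕ → ℕ × ℕ
    reduce (a , b) = a ∸ b , b ∸ a

    reduce-≡ : ∀ a b → (a ∸ b) ℕ.+ b ≡ a ℕ.+ (b ∸ a)
    reduce-≡ zero zero = ≡.refl
    reduce-≡ zero (suc b) = ≡.refl
    reduce-≡ (suc a) zero = ≡.refl
    reduce-≡ (suc a) (suc b) = ≡.trans (ℕ.+-suc (a ∸ b) b) (≡.cong suc (reduce-≡ a b))

    Diff : RawRing _ _
    Diff = record
      { Carrier = ℕ × ℕ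
      ; _≈_ = _≡_
      ; _+_ = λ { (a , b) (c , d) → reduce (a ℕ.+ c , b ℕ.+ d) }
      ; _*_ = λ { (a , b) (c , d) → reduce (a ℕ.* c ℕ.+ b ℕ.* d , a ℕ.* d ℕ.+ b ℕ.* c) }
      ; -_ = λ { (a , b) → b , a }
      ; 0# = 0 , 0
      ; 1# = 1 , 0
      }

    ν : ℕ → Carrier
    ν n = n ×ᵣ 1#

    -- The case b = 0 is singled out so that the coefficient 1 evaluates to 1# itself.
    value : ℕ × ℕ → Carrier
    value (a , zero) = ν a
    value (a , suc b) = ν a - ν (suc b)

    value-diff : ∀ a b → value (a , b) ≈ ν a - ν b
    value-diff a zero = sym (trans (+-congˡ -0#≈0#) (+-identityʳ _))
    value-diff a (suc b) = refl

    value-+ : ∀ a b c d → value (a ℕ.+ c , b ℕ.+ d) ≈ value (a , b) + value (c , d)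
    value-+ a b c d = begin
      value (a ℕ.+ c , b ℕ.+ d)           ≈⟨ value-diff (a ℕ.+ c) (b ℕ.+ d) ⟩
      ν (a ℕ.+ c) - ν (b ℕ.+ d)           ≈⟨ +-cong (×-homo-+ 1# a c) (-‿cong (×-homo-+ 1# b d)) ⟩
      (ν a + ν c) - (ν b + ν d)           ≈⟨ +-congˡ (⁻¹-∙-comm (ν b) (ν d)) ⟨
      (ν a + ν c) + (- ν b - ν d)         ≈⟨ interchange _ _ _ _ ⟩
      (ν a - ν b) + (ν c - ν d)           ≈⟨ +-cong (value-diff a b) (value-diff c d) ⟨
      value (a , b) + value (c , d)       ∎

    value-* : ∀ a b c d →
              value (a ℕ.* c ℕ.+ b ℕ.* d , a ℕ.* d ℕ.+ b ℕ.* c) ≈ value (a , b) * value (c , d)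
    value-* a b c d = begin
      value (a ℕ.* c ℕ.+ b ℕ.* d , a ℕ.* d ℕ.+ b ℕ.* c)
        ≈⟨ value-diff (a ℕ.* c ℕ.+ b ℕ.* d) (a ℕ.* d ℕ.+ b ℕ.* c) ⟩
      ν (a ℕ.* c ℕ.+ b ℕ.* d) - ν (a ℕ.* d ℕ.+ b ℕ.* c)
        ≈⟨ +-cong (expand a c b d) (-‿cong (expand a d b c)) ⟩
      (ν a * ν c + ν b * ν d) - (ν a * ν d + ν b * ν c)
        ≈⟨ +-congˡ (⁻¹-∙-comm _ _) ⟨
      (ν a * ν c + ν b * ν d) + (- (ν a * ν d) - ν b * ν c)
        ≈⟨ +-congˡ (+-comm _ _) ⟩
      (ν a * ν c + ν b * ν d) + (- (ν b * ν c) - ν a * ν d)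
        ≈⟨ interchange _ _ _ _ ⟩
      (ν a * ν c - ν b * ν c) + (ν b * ν d - ν a * ν d)
        ≈⟨ +-congˡ (+-comm _ _) ⟩
      (ν a * ν c - ν b * ν c) + (- (ν a * ν d) + ν b * ν d)
        ≈⟨ +-cong (+-congˡ (-‿distribˡ-* _ _)) (+-cong (-‿distribʳ-* _ _) double-neg) ⟩
      (ν a * ν c + - ν b * ν c) + (ν a * - ν d + - ν b * - ν d)
        ≈⟨ +-cong (distribʳ _ _ _) (distribʳ _ _ _) ⟨
      (ν a - ν b) * ν c + (ν a - ν b) * - ν d
        ≈⟨ distribˡ _ _ _ ⟨
      (ν a - ν b) * (ν c - ν d)
        ≈⟨ *-cong (value-diff a b) (value-diff c d) ⟨
      value (a , b) * value (c , d) ∎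
      where
      expand : ∀ k l m n → ν (k ℕ.* l ℕ.+ m ℕ.* n) ≈ ν k * ν l + ν m * ν n
      expand k l m n =
        trans (×-homo-+ 1# (k ℕ.* l) (m ℕ.* n)) (+-cong (×1-homo-* k l) (×1-homo-* m n))
      double-neg : ν b * ν d ≈ - ν b * - ν d
      double-neg = begin
        ν b * ν d         ≈⟨ ⁻¹-involutive _ ⟨
        - (- (ν b * ν d)) ≈⟨ -‿cong (-‿distribˡ-* _ _) ⟩
        - (- ν b * ν d)   ≈⟨ -‿distribʳ-* _ _ ⟩
        - ν b * - ν d     ∎

    value-neg : ∀ a b → value (b , a) ≈ - value (a , b)
    value-neg a b = begin
      value (b , a)     ≈⟨ value-diff b a ⟩
      ν b - ν a         ≈⟨ +-comm _ _ ⟩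
      - ν a + ν b       ≈⟨ +-congˡ (⁻¹-involutive _) ⟨
      - ν a - (- ν b)   ≈⟨ ⁻¹-∙-comm _ _ ⟩
      - (ν a - ν b)     ≈⟨ -‿cong (value-diff a b) ⟨
      - value (a , b)   ∎

    value-≈ : ∀ a b c d → a ℕ.+ d ≡ c ℕ.+ b → value (a , b) ≈ value (c , d)
    value-≈ a b c d eq = begin
      value (a , b)                     ≈⟨ value-diff a b ⟩
      ν a - ν b                         ≈⟨ +-identityʳ _ ⟨
      (ν a - ν b) + 0#                  ≈⟨ +-congˡ (-‿inverseʳ (ν d)) ⟨
      (ν a - ν b) + (ν d - ν d)         ≈⟨ interchange _ _ _ _ ⟩
      (ν a + ν d) + (- ν b - ν d)       ≈⟨ +-congʳ (×-homo-+ 1# a d) ⟨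
      ν (a ℕ.+ d) + (- ν b - ν d)       ≡⟨ ≡.cong (λ k → ν k + (- ν b - ν d)) eq ⟩
      ν (c ℕ.+ b) + (- ν b - ν d)       ≈⟨ +-cong (×-homo-+ 1# c b) (+-comm _ _) ⟩
      (ν c + ν b) + (- ν d - ν b)       ≈⟨ interchange _ _ _ _ ⟩
      (ν c - ν d) + (ν b - ν b)         ≈⟨ +-congˡ (-‿inverseʳ (ν b)) ⟩
      (ν c - ν d) + 0#                  ≈⟨ +-identityʳ _ ⟩
      ν c - ν d                         ≈⟨ value-diff c d ⟨
      value (c , d)                     ∎

    value-reduce : ∀ a b → value (reduce (a , b)) ≈ value (a , b)
    value-reduce a b = value-≈ (a ∸ b) (b ∸ a) a b (reduce-≡ a b)

    morphism : Diff -Raw-AlmostCommutative⟶ fromCommutativeRing R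
    morphism = record
      { ⟦_⟧ = value
      ; +-homo = λ { (a , b) (c , d) → trans (value-reduce (a ℕ.+ c) (b ℕ.+ d)) (value-+ a b c d) }
      ; *-homo = λ { (a , b) (c , d) →
          trans (value-reduce (a ℕ.* c ℕ.+ b ℕ.* d) (a ℕ.* d ℕ.+ b ℕ.* c)) (value-* a b c d) }
      ; -‿homo = λ { (a , b) → value-neg a b }
      ; 0-homo = refl
      ; 1-homo = refl
      }

    value-≟ : (x y : ℕ × ℕ) → Maybe (value x ≈ value y)
    value-≟ (a , b) (c , d) with (a ℕ.+ d) ℕ.≟ (c ℕ.+ b)
    ... | yes eq = just (value-≈ a b c d eq)
    ... | no _ = nothing

  open import Algebra.Solver.Ring Diff (fromCommutativeRing R) morphism value-≟ public
    using (solve; _:=_; _:+_; _:*_; _:-_; :-_; con; Polynomial)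

  :1 :0 : ∀ {n} → Polynomial n
  :1 = con (1 , 0)
  :0 = con (0 , 0)

-- Ring homomorphisms and finite sums.

module Homomorphism {a ℓ₁ b ℓ₂} (A : CommutativeRing a ℓ₁) (B : CommutativeRing b ℓ₂) where
  private
    module A = CommutativeRing A
    module B = CommutativeRing B

  -- Preservation of 0 and of negatives follows from additivity, since the target is a group under
  -- addition.
  isRingHomomorphism : (h : A.Carrier → B.Carrier) →
    (∀ {x y} → x A.≈ y → h x B.≈ h y) →
    (∀ x y → h (x A.+ y) B.≈ h x B.+ h y) →
    (∀ x y → h (x A.* y) B.≈ h x B.* h y) →
    h A.1# B.≈ B.1# →
    IsRingHomomorphism A.rawRing B.rawRing h
  isRingHomomorphism h h-cong h-+ h-* h-1 = record
    { isSemiringHomomorphism = record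
      { isNearSemiringHomomorphism = record
        { +-isMonoidHomomorphism = record
          { isMagmaHomomorphism = record
            { isRelHomomorphism = record { cong = h-cong }
            ; homo = h-+ }
          ; ε-homo = h-0 }
        ; *-homo = h-* }
      ; 1#-homo = h-1 }
    ; -‿homo = h-neg }
    where
    open import Algebra.Properties.Ring B.ring using (x+x≈x⇒x≈0)
    open import Algebra.Properties.Group B.+-group using (inverseˡ-unique)
    h-0 : h A.0# B.≈ B.0#
    h-0 = x+x≈x⇒x≈0 _ (B.trans (B.sym (h-+ _ _)) (h-cong (A.+-identityˡ _)))
    h-neg : ∀ x → h (A.- x) B.≈ B.- h x
    h-neg x = inverseˡ-unique _ _
      (B.trans (B.sym (h-+ _ _)) (B.trans (h-cong (A.-‿inverseˡ x)) h-0))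

module Sums {c ℓ} (R : CommutativeRing c ℓ) where
  open CommutativeRing R hiding (zero)
  open PowerSeries R using (sumUpTo)
  open import Algebra.Properties.CommutativeSemigroup +-commutativeSemigroup using (interchange)

  sumUpTo-cong : ∀ n {f g : ℕ → Carrier} → (∀ i → i < n → f i ≈ g i) → sumUpTo n f ≈ sumUpTo n g
  sumUpTo-cong zero f≈g = refl
  sumUpTo-cong (suc n) f≈g =
    +-cong (sumUpTo-cong n (λ i i<n → f≈g i (ℕ.m<n⇒m<1+n i<n))) (f≈g n ℕ.≤-refl)

  sumUpTo-zero : ∀ n {f : ℕ → Carrier} → (∀ i → i < n → f i ≈ 0#) → sumUpTo n f ≈ 0#
  sumUpTo-zero zero f≈0 = refl
  sumUpTo-zero (suc n) f≈0 =
    trans (+-cong (sumUpTo-zero n (λ i i<n → f≈0 i (ℕ.m<n⇒m<1+n i<n))) (f≈0 n ℕ.≤-refl))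
          (+-identityˡ 0#)

  sumUpTo-+ : ∀ n (f g : ℕ → Carrier) →
              sumUpTo n (λ i → f i + g i) ≈ sumUpTo n f + sumUpTo n g
  sumUpTo-+ zero f g = sym (+-identityˡ 0#)
  sumUpTo-+ (suc n) f g = trans (+-congʳ (sumUpTo-+ n f g)) (interchange _ _ _ _)

  *-sumUpTo : ∀ n a (f : ℕ → Carrier) → a * sumUpTo n f ≈ sumUpTo n (λ i → a * f i)
  *-sumUpTo zero a f = zeroʳ a
  *-sumUpTo (suc n) a f = trans (distribˡ _ _ _) (+-congʳ (*-sumUpTo n a f))

  sumUpTo-head : ∀ n (f : ℕ → Carrier) →
                 sumUpTo (suc n) f ≈ f 0 + sumUpTo n (λ i → f (suc i))
  sumUpTo-head zero f = +-comm _ _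
  sumUpTo-head (suc n) f = trans (+-congʳ (sumUpTo-head n f)) (+-assoc _ _ _)

  sumUpTo-only : ∀ n k {f : ℕ → Carrier} → k < n →
                 (∀ i → ¬ (i ≡ k) → f i ≈ 0#) → sumUpTo n f ≈ f k
  sumUpTo-only (suc n) k {f} k<1+n f≈0 with n ℕ.≟ k
  ... | yes ≡.refl =
    trans (+-congʳ (sumUpTo-zero n (λ i i<n → f≈0 i (ℕ.<⇒≢ i<n)))) (+-identityˡ _)
  ... | no n≢k =
    trans (+-cong (sumUpTo-only n k (ℕ.≤∧≢⇒< (ℕ.≤-pred k<1+n) (λ eq → n≢k (≡.sym eq))) f≈0)
                  (f≈0 n n≢k))
          (+-identityʳ _)

-- Formal power series as a commutative ring.

module Series {c ℓ} (R : CommutativeRing c ℓ) where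
  open CommutativeRing R hiding (zero)
  open PowerSeries R
  open Sums R
  open IntegerSolver R
  open import Relation.Binary.Reasoning.Setoid setoid

  tail : PS → PS
  tail f n = f (suc n)

  ⊛-cong : ∀ {f f′ g g′} → f ≈PS f′ → g ≈PS g′ → (f ⊛ g) ≈PS (f′ ⊛ g′)
  ⊛-cong f≈ g≈ n = sumUpTo-cong (suc n) (λ i _ → *-cong (f≈ i) (g≈ (n ∸ i)))

  ⊛-zero : ∀ f g → (f ⊛ g) 0 ≈ f 0 * g 0
  ⊛-zero f g = +-identityˡ _

  ⊛-suc : ∀ f g n → (f ⊛ g) (suc n) ≈ f 0 * g (suc n) + (tail f ⊛ g) n
  ⊛-suc f g n = sumUpTo-head (suc n) (λ i → f i * g (suc n ∸ i))

  ⊛-last : ∀ f g n → (f ⊛ g) (suc n) ≈ (f ⊛ tail g) n + f (suc n) * g 0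
  ⊛-last f g n = +-cong
    (sumUpTo-cong (suc n) (λ i i≤n → *-congˡ (reflexive (≡.cong g (ℕ.+-∸-assoc 1 (ℕ.≤-pred i≤n))))))
    (*-congˡ (reflexive (≡.cong g (ℕ.n∸n≡0 n))))

  -- Splitting the first term off one convolution and the last term off the other leaves the same
  -- statement at a lower index, so no reindexing of sums is needed.
  ⊛-comm : ∀ f g → (f ⊛ g) ≈PS (g ⊛ f)
  ⊛-comm f g zero = +-congˡ (*-comm _ _)
  ⊛-comm f g (suc n) = begin
    (f ⊛ g) (suc n)                     ≈⟨ ⊛-suc f g n ⟩
    f 0 * g (suc n) + (tail f ⊛ g) n    ≈⟨ +-cong (*-comm _ _) (⊛-comm (tail f) g n) ⟩
    g (suc n) * f 0 + (g ⊛ tail f) n    ≈⟨ +-comm _ _ ⟩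
    (g ⊛ tail f) n + g (suc n) * f 0    ≈⟨ ⊛-last g f n ⟨
    (g ⊛ f) (suc n)                     ∎

  ⊛-distribʳ : ∀ h f g → ((f ⊕ g) ⊛ h) ≈PS ((f ⊛ h) ⊕ (g ⊛ h))
  ⊛-distribʳ h f g n = trans
    (sumUpTo-cong (suc n) (λ i _ → distribʳ (h (n ∸ i)) (f i) (g i)))
    (sumUpTo-+ (suc n) (λ i → f i * h (n ∸ i)) (λ i → g i * h (n ∸ i)))

  ·-⊛ : ∀ a f g → ((a · f) ⊛ g) ≈PS (a · (f ⊛ g))
  ·-⊛ a f g n = sym (trans
    (*-sumUpTo (suc n) a (λ i → f i * g (n ∸ i)))
    (sumUpTo-cong (suc n) (λ i _ → sym (*-assoc a (f i) (g (n ∸ i))))))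

  ⊛-zeroˡ : ∀ {f} g → (∀ n → f n ≈ 0#) → ∀ n → (f ⊛ g) n ≈ 0#
  ⊛-zeroˡ g f≈0 n = sumUpTo-zero (suc n) (λ i _ → trans (*-congʳ (f≈0 i)) (zeroˡ _))

  -- Induction on the index with f replaced by its tail: the tail of f g is f(0) times the tail of
  -- g, plus (tail f) g. Double sums never appear.
  ⊛-assoc : ∀ f g h → ((f ⊛ g) ⊛ h) ≈PS (f ⊛ (g ⊛ h))
  ⊛-assoc f g h zero = begin
    ((f ⊛ g) ⊛ h) 0     ≈⟨ ⊛-zero (f ⊛ g) h ⟩
    (f ⊛ g) 0 * h 0     ≈⟨ *-congʳ (⊛-zero f g) ⟩
    f 0 * g 0 * h 0     ≈⟨ *-assoc _ _ _ ⟩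
    f 0 * (g 0 * h 0)   ≈⟨ *-congˡ (⊛-zero g h) ⟨
    f 0 * (g ⊛ h) 0     ≈⟨ ⊛-zero f (g ⊛ h) ⟨
    (f ⊛ (g ⊛ h)) 0     ∎
  ⊛-assoc f g h (suc n) = begin
    ((f ⊛ g) ⊛ h) (suc n)
      ≈⟨ ⊛-suc (f ⊛ g) h n ⟩
    (f ⊛ g) 0 * h (suc n) + (tail (f ⊛ g) ⊛ h) n
      ≈⟨ +-cong (*-congʳ (⊛-zero f g)) (⊛-cong {g = h} (⊛-suc f g) (λ _ → refl) n) ⟩
    f 0 * g 0 * h (suc n) + (((f 0 · tail g) ⊕ (tail f ⊛ g)) ⊛ h) n
      ≈⟨ +-congˡ (⊛-distribʳ h (f 0 · tail g) (tail f ⊛ g) n) ⟩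
    f 0 * g 0 * h (suc n) + (((f 0 · tail g) ⊛ h) n + ((tail f ⊛ g) ⊛ h) n)
      ≈⟨ +-congˡ (+-cong (·-⊛ (f 0) (tail g) h n) (⊛-assoc (tail f) g h n)) ⟩
    f 0 * g 0 * h (suc n) + (f 0 * (tail g ⊛ h) n + (tail f ⊛ (g ⊛ h)) n)
      ≈⟨ solve 5 (λ a b c x y → a :* b :* c :+ (a :* x :+ y) := a :* (b :* c :+ x) :+ y)
               refl (f 0) (g 0) (h (suc n)) ((tail g ⊛ h) n) ((tail f ⊛ (g ⊛ h)) n) ⟩
    f 0 * (g 0 * h (suc n) + (tail g ⊛ h) n) + (tail f ⊛ (g ⊛ h)) n
      ≈⟨ +-congʳ (*-congˡ (⊛-suc g h n)) ⟨
    f 0 * (g ⊛ h) (suc n) + (tail f ⊛ (g ⊛ h)) n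
      ≈⟨ ⊛-suc f (g ⊛ h) n ⟨
    (f ⊛ (g ⊛ h)) (suc n) ∎

  const-⊛ : ∀ a f → (const a ⊛ f) ≈PS (a · f)
  const-⊛ a f zero = +-identityˡ _
  const-⊛ a f (suc n) = begin
    (const a ⊛ f) (suc n)                    ≈⟨ ⊛-suc (const a) f n ⟩
    a * f (suc n) + (tail (const a) ⊛ f) n   ≈⟨ +-congˡ (⊛-zeroˡ f (λ _ → refl) n) ⟩
    a * f (suc n) + 0#                       ≈⟨ +-identityʳ _ ⟩
    a * f (suc n)                            ∎

  ⊛-identityˡ : ∀ f → (𝟙 ⊛ f) ≈PS f
  ⊛-identityˡ f n = trans (const-⊛ 1# f n) (*-identityˡ (f n))

  𝟘≈0 : ∀ n → 𝟘 n ≈ 0#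
  𝟘≈0 zero = refl
  𝟘≈0 (suc n) = refl

  seriesRing : CommutativeRing c ℓ
  seriesRing = record
    { Carrier = PS
    ; _≈_ = _≈PS_
    ; _+_ = _⊕_
    ; _*_ = _⊛_
    ; -_ = ⊖_
    ; 0# = 𝟘
    ; 1# = 𝟙
    ; isCommutativeRing = record
      { isRing = record
        { +-isAbelianGroup = record
          { isGroup = record
            { isMonoid = record
              { isSemigroup = record
                { isMagma = record
                  { isEquivalence = record
                    { refl = λ n → refl
                    ; sym = λ f≈g n → sym (f≈g n)
                    ; trans = λ f≈g g≈h n → trans (f≈g n) (g≈h n) }
                  ; ∙-cong = λ f≈ g≈ n → +-cong (f≈ n) (g≈ n) }
                ; assoc = λ f g h n → +-assoc (f n) (g n) (h n) }
              ; identity = (λ f n → trans (+-congʳ (𝟘≈0 n)) (+-identityˡ (f n)))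
                         , (λ f n → trans (+-congˡ (𝟘≈0 n)) (+-identityʳ (f n))) }
            ; inverse = (λ f n → trans (-‿inverseˡ (f n)) (sym (𝟘≈0 n)))
                      , (λ f n → trans (-‿inverseʳ (f n)) (sym (𝟘≈0 n)))
            ; ⁻¹-cong = λ f≈g n → -‿cong (f≈g n) }
          ; comm = λ f g n → +-comm (f n) (g n) }
        ; *-cong = ⊛-cong
        ; *-assoc = ⊛-assoc
        ; *-identity = ⊛-identityˡ , λ f n → trans (⊛-comm f 𝟙 n) (⊛-identityˡ f n)
        ; distrib = (λ h f g n → trans (⊛-comm h (f ⊕ g) n)
                       (trans (⊛-distribʳ h f g n) (+-cong (⊛-comm f h n) (⊛-comm g h n))))
                  , ⊛-distribʳ }
      ; *-comm = ⊛-comm } }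

-- Powers and quotients of differences of powers.

module Powers {c ℓ} (R : CommutativeRing c ℓ) where
  open CommutativeRing R hiding (zero)
  open PowerSeries R using (sumUpTo)
  open Sums R
  open IntegerSolver R
  open import Algebra.Properties.CommutativeSemiring.Exp commutativeSemiring public
    using (_^_; ^-congˡ; ^-homo-*; ^-assocʳ; ^-distrib-*)
  open import Relation.Binary.Reasoning.Setoid setoid

  1^ : ∀ n → 1# ^ n ≈ 1#
  1^ zero = refl
  1^ (suc n) = trans (*-identityˡ _) (1^ n)

  -- powerQuotient n a b = Σ_{j ≤ n} a^j b^{n-j} = (a^{n+1} − b^{n+1}) / (a − b)
  powerQuotient : ℕ → Carrier → Carrier → Carrier
  powerQuotient zero a b = 1#
  powerQuotient (suc n) a b = b * powerQuotient n a b + a ^ suc n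

  powerQuotient-cong : ∀ n {a a′ b b′} → a ≈ a′ → b ≈ b′ →
                       powerQuotient n a b ≈ powerQuotient n a′ b′
  powerQuotient-cong zero a≈ b≈ = refl
  powerQuotient-cong (suc n) a≈ b≈ =
    +-cong (*-cong b≈ (powerQuotient-cong n a≈ b≈)) (^-congˡ (suc n) a≈)

  *-powerQuotient : ∀ n a b → (a - b) * powerQuotient n a b ≈ a ^ suc n - b ^ suc n
  *-powerQuotient zero a b =
    solve 2 (λ a b → (a :- b) :* :1 := a :* :1 :- b :* :1) refl a b
  *-powerQuotient (suc n) a b = begin
    (a - b) * (b * q + a * a^)
      ≈⟨ solve 4 (λ a b q p → (a :- b) :* (b :* q :+ a :* p)
                           := b :* ((a :- b) :* q) :+ (a :* (a :* p) :- b :* (a :* p)))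
               refl a b q a^ ⟩
    b * ((a - b) * q) + (a * (a * a^) - b * (a * a^))
      ≈⟨ +-congʳ (*-congˡ (*-powerQuotient n a b)) ⟩
    b * (a * a^ - b * b^) + (a * (a * a^) - b * (a * a^))
      ≈⟨ solve 4 (λ a b p q → b :* (a :* p :- b :* q) :+ (a :* (a :* p) :- b :* (a :* p))
                           := a :* (a :* p) :- b :* (b :* q))
               refl a b a^ b^ ⟩
    a * (a * a^) - b * (b * b^) ∎
    where
    q = powerQuotient n a b
    a^ = a ^ n
    b^ = b ^ n

  -- The link to `Qpoly`, which is given by the explicit sum; the recursive form is the one that
  -- passes through homomorphisms and inductions.
  powerQuotient-sum : ∀ n a b → sumUpTo (suc n) (λ j → a ^ j * b ^ (n ∸ j)) ≈ powerQuotient n a b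
  powerQuotient-sum zero a b = solve 0 (:0 :+ :1 :* :1 := :1) refl
  powerQuotient-sum (suc n) a b = +-cong
    (begin
      sumUpTo (suc n) (λ j → a ^ j * b ^ (suc n ∸ j))
        ≈⟨ sumUpTo-cong (suc n) (λ j j≤n → begin
             a ^ j * b ^ (suc n ∸ j)
               ≡⟨ ≡.cong (λ k → a ^ j * b ^ k) (ℕ.+-∸-assoc 1 (ℕ.≤-pred j≤n)) ⟩
             a ^ j * (b * b ^ (n ∸ j))
               ≈⟨ solve 3 (λ a b c → a :* (b :* c) := b :* (a :* c)) refl (a ^ j) b (b ^ (n ∸ j)) ⟩
             b * (a ^ j * b ^ (n ∸ j)) ∎) ⟩
      sumUpTo (suc n) (λ j → b * (a ^ j * b ^ (n ∸ j)))
        ≈⟨ *-sumUpTo (suc n) b (λ j → a ^ j * b ^ (n ∸ j)) ⟨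
      b * sumUpTo (suc n) (λ j → a ^ j * b ^ (n ∸ j))
        ≈⟨ *-congˡ (powerQuotient-sum n a b) ⟩
      b * powerQuotient n a b ∎)
    (begin
      a ^ suc n * b ^ (n ∸ n)  ≡⟨ ≡.cong (λ k → a ^ suc n * b ^ k) (ℕ.n∸n≡0 n) ⟩
      a ^ suc n * 1#           ≈⟨ *-identityʳ _ ⟩
      a ^ suc n                ∎)

module HomomorphismPowers {a ℓ₁ b ℓ₂} (A : CommutativeRing a ℓ₁) (B : CommutativeRing b ℓ₂)
  (h : CommutativeRing.Carrier A → CommutativeRing.Carrier B)
  (hom : IsRingHomomorphism (CommutativeRing.rawRing A) (CommutativeRing.rawRing B) h) where
  private
    module A where
      open CommutativeRing A public
      open Powers A public
    module B where
      open CommutativeRing B public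
      open Powers B public
  open IsRingHomomorphism hom

  ^-homo : ∀ x n → h (x A.^ n) B.≈ h x B.^ n
  ^-homo x zero = 1#-homo
  ^-homo x (suc n) = B.trans (*-homo _ _) (B.*-congˡ (^-homo x n))

  minus-homo : ∀ x y → h (x A.- y) B.≈ h x B.- h y
  minus-homo x y = B.trans (+-homo _ _) (B.+-congˡ (-‿homo y))

  powerQuotient-homo : ∀ n x y → h (A.powerQuotient n x y) B.≈ B.powerQuotient n (h x) (h y)
  powerQuotient-homo zero x y = 1#-homo
  powerQuotient-homo (suc n) x y = B.trans (+-homo _ _)
    (B.+-cong (B.trans (*-homo _ _) (B.*-congˡ (powerQuotient-homo n x y))) (^-homo x (suc n)))

-- Powers of X, cancellation, geometric series and the Euler operator.

module SeriesProperties {c ℓ} (R : CommutativeRing c ℓ) where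
  open CommutativeRing R hiding (zero)
  open PowerSeries R
  open Series R
  open IntegerSolver R
  open import Relation.Binary.Reasoning.Setoid setoid
  module S where
    open CommutativeRing seriesRing public
    open Powers seriesRing public
    open IntegerSolver seriesRing public
  import Relation.Binary.Reasoning.Setoid S.setoid as SR

  ^^≡^ : ∀ f n → (f ^^ n) ≡ (f S.^ n)
  ^^≡^ f zero = ≡.refl
  ^^≡^ f (suc n) = ≡.cong (f ⊛_) (^^≡^ f n)

  ^^≈^ : ∀ f n → (f ^^ n) ≈PS (f S.^ n)
  ^^≈^ f n = S.reflexive (^^≡^ f n)

  const-+ : ∀ a b → const (a + b) ≈PS (const a ⊕ const b)
  const-+ a b zero = refl
  const-+ a b (suc n) = sym (+-identityˡ 0#)

  const-* : ∀ a b → const (a * b) ≈PS (const a ⊛ const b)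
  const-* a b zero = sym (const-⊛ a (const b) 0)
  const-* a b (suc n) = sym (trans (const-⊛ a (const b) (suc n)) (zeroʳ a))

  const-cong : ∀ {a b} → a ≈ b → const a ≈PS const b
  const-cong a≈b zero = a≈b
  const-cong a≈b (suc n) = refl

  head-isRingHomomorphism :
    IsRingHomomorphism S.rawRing (CommutativeRing.rawRing R) (λ f → f 0)
  head-isRingHomomorphism = Homomorphism.isRingHomomorphism seriesRing R (λ f → f 0)
    (λ f≈g → f≈g 0) (λ f g → refl) ⊛-zero refl

  open HomomorphismPowers seriesRing R (λ f → f 0) head-isRingHomomorphism public
    using () renaming (^-homo to ^-head; powerQuotient-homo to powerQuotient-head)

  tail-X : ∀ n → tail X n ≈ 𝟙 n
  tail-X zero = refl
  tail-X (suc n) = refl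

  X⊛-zero : ∀ f → (X ⊛ f) 0 ≈ 0#
  X⊛-zero f = trans (⊛-zero X f) (zeroˡ _)

  X⊛-suc : ∀ f n → (X ⊛ f) (suc n) ≈ f n
  X⊛-suc f n = begin
    (X ⊛ f) (suc n)                     ≈⟨ ⊛-suc X f n ⟩
    0# * f (suc n) + (tail X ⊛ f) n     ≈⟨ +-cong (zeroˡ _) (⊛-cong {g = f} tail-X (λ _ → refl) n) ⟩
    0# + (𝟙 ⊛ f) n                      ≈⟨ +-identityˡ _ ⟩
    (𝟙 ⊛ f) n                           ≈⟨ ⊛-identityˡ f n ⟩
    f n                                 ∎

  X⊛-tail : ∀ f → f 0 ≈ 0# → f ≈PS (X ⊛ tail f)
  X⊛-tail f f0≈0 zero = trans f0≈0 (sym (X⊛-zero (tail f)))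
  X⊛-tail f f0≈0 (suc n) = sym (X⊛-suc (tail f) n)

  X^-cancel : ∀ m f g → ((X S.^ m) ⊛ f) ≈PS ((X S.^ m) ⊛ g) → f ≈PS g
  X^-cancel zero f g eq = S.trans (S.sym (S.*-identityˡ f)) (S.trans eq (S.*-identityˡ g))
  X^-cancel (suc m) f g eq = X^-cancel m f g λ n → begin
    (X^m ⊛ f) n                  ≈⟨ X⊛-suc (X^m ⊛ f) n ⟨
    (X ⊛ (X^m ⊛ f)) (suc n)      ≈⟨ S.*-assoc X X^m f (suc n) ⟨
    ((X ⊛ X^m) ⊛ f) (suc n)      ≈⟨ eq (suc n) ⟩
    ((X ⊛ X^m) ⊛ g) (suc n)      ≈⟨ S.*-assoc X X^m g (suc n) ⟩
    (X ⊛ (X^m ⊛ g)) (suc n)      ≈⟨ X⊛-suc (X^m ⊛ g) n ⟩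
    (X^m ⊛ g) n                  ∎
    where X^m = X S.^ m

  X^-same : ∀ m → (X S.^ m) m ≈ 1#
  X^-same zero = refl
  X^-same (suc m) = trans (X⊛-suc (X S.^ m) m) (X^-same m)

  X^-other : ∀ m n → ¬ (n ≡ m) → (X S.^ m) n ≈ 0#
  X^-other zero zero n≢m = ⊥-elim (n≢m ≡.refl)
  X^-other zero (suc n) n≢m = refl
  X^-other (suc m) zero n≢m = X⊛-zero (X S.^ m)
  X^-other (suc m) (suc n) n≢m =
    trans (X⊛-suc (X S.^ m) n) (X^-other m n (λ eq → n≢m (≡.cong suc eq)))

  -- A regular constant term of g forces f(0) = 0; then (tail f) g vanishes as well, and the
  -- argument repeats.
  ⊛-cancel-0 : ∀ f g → (∀ x → x * g 0 ≈ 0# → x ≈ 0#) → (f ⊛ g) ≈PS 𝟘 → f ≈PS 𝟘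
  ⊛-cancel-0 f g reg fg≈0 zero = reg _ (trans (sym (⊛-zero f g)) (fg≈0 0))
  ⊛-cancel-0 f g reg fg≈0 (suc n) = trans (⊛-cancel-0 (tail f) g reg tail≈0 n) (𝟘≈0 n)
    where
    f0≈0 = ⊛-cancel-0 f g reg fg≈0 zero
    tail≈0 : (tail f ⊛ g) ≈PS 𝟘
    tail≈0 k = begin
      (tail f ⊛ g) k                        ≈⟨ +-identityˡ _ ⟨
      0# + (tail f ⊛ g) k                   ≈⟨ +-congʳ (trans (*-congʳ f0≈0) (zeroˡ _)) ⟨
      f 0 * g (suc k) + (tail f ⊛ g) k      ≈⟨ ⊛-suc f g k ⟨
      (f ⊛ g) (suc k)                       ≈⟨ fg≈0 (suc k) ⟩
      0#                                    ≈⟨ 𝟘≈0 k ⟨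
      𝟘 k                                   ∎

  lin-⊛-geom : ∀ a → (lin a ⊛ geom a) ≈PS 𝟙
  lin-⊛-geom a zero = trans (⊛-zero (lin a) (geom a)) (*-identityˡ _)
  lin-⊛-geom a (suc n) = begin
    (lin a ⊛ geom a) (suc n)
      ≈⟨ ⊛-suc (lin a) (geom a) n ⟩
    1# * (a * a ^ᶜ n) + (tail (lin a) ⊛ geom a) n
      ≈⟨ +-congˡ (⊛-cong {g = geom a} tail-lin (λ _ → refl) n) ⟩
    1# * (a * a ^ᶜ n) + (const (- a) ⊛ geom a) n
      ≈⟨ +-congˡ (const-⊛ (- a) (geom a) n) ⟩
    1# * (a * a ^ᶜ n) + - a * a ^ᶜ n
      ≈⟨ solve 2 (λ a p → :1 :* (a :* p) :+ (:- a) :* p := :0) refl a (a ^ᶜ n) ⟩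
    0# ∎
    where
    tail-lin : tail (lin a) ≈PS const (- a)
    tail-lin zero = refl
    tail-lin (suc n) = refl

  lin≈ : ∀ a → lin a ≈PS (𝟙 ⊝ (const a ⊛ X))
  lin≈ a zero = solve 1 (λ a → :1 := :1 :- (:0 :+ a :* :0)) refl a
  lin≈ a (suc zero) = trans (solve 1 (λ a → :- a := :0 :- a :* :1) refl a)
                            (+-congˡ (-‿cong (sym (const-⊛ a X 1))))
  lin≈ a (suc (suc n)) = trans (solve 1 (λ a → :0 := :0 :- a :* :0) refl a)
                               (+-congˡ (-‿cong (sym (const-⊛ a X (suc (suc n))))))

  const-natᶜ-suc : ∀ n → const (natᶜ (suc n)) ≈PS (𝟙 ⊕ const (natᶜ n))
  const-natᶜ-suc n = const-+ 1# (natᶜ n)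

  -- The Euler operator X d/dX.
  θ : PS → PS
  θ f n = natᶜ n * f n

  θ-cong : ∀ {f g} → f ≈PS g → θ f ≈PS θ g
  θ-cong f≈g n = *-congˡ (f≈g n)

  θ-⊕ : ∀ f g → θ (f ⊕ g) ≈PS (θ f ⊕ θ g)
  θ-⊕ f g n = distribˡ _ _ _

  θ-const : ∀ a → θ (const a) ≈PS 𝟘
  θ-const a zero = zeroˡ a
  θ-const a (suc n) = zeroʳ _

  θ-⊖ : ∀ f → θ (⊖ f) ≈PS (⊖ θ f)
  θ-⊖ f n = solve 2 (λ k x → k :* (:- x) := :- (k :* x)) refl (natᶜ n) (f n)

  θ-X : θ X ≈PS X
  θ-X zero = zeroˡ _
  θ-X (suc zero) = solve 0 ((:1 :+ :0) :* :1 := :1) refl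
  θ-X (suc (suc n)) = zeroʳ _

  -- Induction on the index: passing to the tail of f lowers each degree weight by one, and `tail-θ`
  -- puts the missing unit back.
  θ-⊛ : ∀ f g → θ (f ⊛ g) ≈PS ((θ f ⊛ g) ⊕ (f ⊛ θ g))
  θ-⊛ f g zero = solve 2 (λ a b → :0 :* (:0 :+ a :* b)
                                 := (:0 :+ :0 :* a :* b) :+ (:0 :+ a :* (:0 :* b)))
                       refl (f 0) (g 0)
  θ-⊛ f g (suc n) = begin
    (1# + ν) * (f ⊛ g) (suc n)
      ≈⟨ *-congˡ (⊛-suc f g n) ⟩
    (1# + ν) * (f 0 * g (suc n) + t)
      ≈⟨ solve 4 (λ k a b t → (:1 :+ k) :* (a :* b :+ t)
                            := :0 :* a :* b :+ (t :+ k :* t) :+ a :* ((:1 :+ k) :* b) )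
               refl ν (f 0) (g (suc n)) t ⟩
    0# * f 0 * g (suc n) + (t + ν * t) + f 0 * ((1# + ν) * g (suc n))
      ≈⟨ +-congʳ (+-congˡ (+-congˡ (θ-⊛ (tail f) g n))) ⟩
    0# * f 0 * g (suc n) + (t + (x + y)) + f 0 * ((1# + ν) * g (suc n))
      ≈⟨ solve 5 (λ a t x y b → a :+ (t :+ (x :+ y)) :+ b := (a :+ (t :+ x)) :+ (b :+ y))
               refl _ t x y _ ⟩
    (0# * f 0 * g (suc n) + (t + x)) + (f 0 * ((1# + ν) * g (suc n)) + y)
      ≈⟨ +-congʳ (+-congˡ (⊛-distribʳ g (tail f) (θ (tail f)) n)) ⟨
    (0# * f 0 * g (suc n) + ((tail f ⊕ θ (tail f)) ⊛ g) n) + (f 0 * ((1# + ν) * g (suc n)) + y)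
      ≈⟨ +-congʳ (+-congˡ (⊛-cong {g = g} tail-θ (λ _ → refl) n)) ⟨
    (0# * f 0 * g (suc n) + (tail (θ f) ⊛ g) n) + (f 0 * ((1# + ν) * g (suc n)) + y)
      ≈⟨ +-cong (⊛-suc (θ f) g n) (⊛-suc f (θ g) n) ⟨
    (θ f ⊛ g) (suc n) + (f ⊛ θ g) (suc n) ∎
    where
    ν = natᶜ n
    t = (tail f ⊛ g) n
    x = (θ (tail f) ⊛ g) n
    y = (tail f ⊛ θ g) n
    tail-θ : tail (θ f) ≈PS (tail f ⊕ θ (tail f))
    tail-θ k = solve 2 (λ k a → (:1 :+ k) :* a := a :+ k :* a) refl (natᶜ k) (f (suc k))

  -- The power rule multiplied by f, which avoids the exponent m - 1 and its special case at m = 0.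
  ⊛-θ-^ : ∀ f m → (f ⊛ θ (f S.^ m)) ≈PS (const (natᶜ m) ⊛ ((f S.^ m) ⊛ θ f))
  ⊛-θ-^ f zero = SR.begin
    f ⊛ θ 𝟙                       SR.≈⟨ S.*-congˡ {f} (θ-const 1#) ⟩
    f ⊛ 𝟘                         SR.≈⟨ S.zeroʳ f ⟩
    𝟘                             SR.≈⟨ S.zeroˡ (𝟙 ⊛ θ f) ⟨
    𝟘 ⊛ (𝟙 ⊛ θ f)                 SR.∎
  ⊛-θ-^ f (suc m) = SR.begin
    f ⊛ θ (f ⊛ p)
      SR.≈⟨ S.*-congˡ {f} (θ-⊛ f p) ⟩
    f ⊛ ((θ f ⊛ p) ⊕ (f ⊛ θ p))
      SR.≈⟨ S.*-congˡ {f} (S.+-congˡ {θ f ⊛ p} (⊛-θ-^ f m)) ⟩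
    f ⊛ ((θ f ⊛ p) ⊕ (const (natᶜ m) ⊛ (p ⊛ θ f)))
      SR.≈⟨ S.solve 4 (λ f t p k → f S.:* (t S.:* p S.:+ k S.:* (p S.:* t))
                                 S.:= (S.:1 S.:+ k) S.:* ((f S.:* p) S.:* t))
                    S.refl f (θ f) p (const (natᶜ m)) ⟩
    (𝟙 ⊕ const (natᶜ m)) ⊛ ((f ⊛ p) ⊛ θ f)
      SR.≈⟨ S.*-congʳ {(f ⊛ p) ⊛ θ f} (const-natᶜ-suc m) ⟨
    const (natᶜ (suc m)) ⊛ ((f ⊛ p) ⊛ θ f) SR.∎
    where p = f S.^ m

-- Substitution of a series without constant term.

module Composition {c ℓ} (R : CommutativeRing c ℓ)
  (s : PowerSeries.PS R)
  (s0≈0 : CommutativeRing._≈_ R (s 0) (CommutativeRing.0# R)) where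
  open CommutativeRing R hiding (zero)
  open PowerSeries R
  open Sums R
  open Series R
  open SeriesProperties R
  open import Relation.Binary.Reasoning.Setoid setoid
  import Relation.Binary.Reasoning.Setoid S.setoid as SR

  -- Since s(0) = 0, multiplication by s raises the degree. This makes each coefficient of a
  -- composite depend on finitely many Horner steps, and it is the source of well-founded inductions
  -- below.
  ⊛-agree : ∀ n g g′ → (∀ i → i < n → g i ≈ g′ i) → (s ⊛ g) n ≈ (s ⊛ g′) n
  ⊛-agree zero g g′ g≈g′ = +-congˡ (trans (trans (*-congʳ s0≈0) (zeroˡ _))
                                          (sym (trans (*-congʳ s0≈0) (zeroˡ _))))
  ⊛-agree (suc n) g g′ g≈g′ = begin
    (s ⊛ g) (suc n)                         ≈⟨ ⊛-suc s g n ⟩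
    s 0 * g (suc n) + (tail s ⊛ g) n        ≈⟨ +-cong (trans (vanish _) (sym (vanish _)))
                                                 (sumUpTo-cong (suc n) (λ i _ →
                                                   *-congˡ (g≈g′ (n ∸ i) (s≤s (ℕ.m∸n≤m n i))))) ⟩
    s 0 * g′ (suc n) + (tail s ⊛ g′) n      ≈⟨ ⊛-suc s g′ n ⟨
    (s ⊛ g′) (suc n)                        ∎
    where
    vanish : ∀ x → s 0 * x ≈ 0#
    vanish x = trans (*-congʳ s0≈0) (zeroˡ x)

  horner : ℕ → PS → PS
  horner zero f = 𝟘
  horner (suc m) f = const (f 0) ⊕ (s ⊛ horner m (tail f))

  -- f ↦ f ∘ s; the first n + 1 coefficients of f determine the n-th one of f ∘ s.
  compose : PS → PS
  compose f n = horner (suc n) f n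

  horner-stable : ∀ m m′ f n → n < m → n < m′ → horner m f n ≈ horner m′ f n
  horner-stable (suc m) (suc m′) f n (s≤s n≤m) (s≤s n≤m′) =
    +-congˡ (⊛-agree n (horner m (tail f)) (horner m′ (tail f)) λ i i<n →
      horner-stable m m′ (tail f) i (ℕ.<-≤-trans i<n n≤m) (ℕ.<-≤-trans i<n n≤m′))

  compose-unfold : ∀ f → compose f ≈PS (const (f 0) ⊕ (s ⊛ compose (tail f)))
  compose-unfold f n = +-congˡ (⊛-agree n (horner n (tail f)) (compose (tail f)) λ i i<n →
    horner-stable n (suc i) (tail f) i i<n ℕ.≤-refl)

  horner-cong : ∀ m {f g} → f ≈PS g → horner m f ≈PS horner m g
  horner-cong zero f≈g = S.refl
  horner-cong (suc m) f≈g = S.+-cong (const-cong (f≈g 0))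
    (⊛-cong {s} S.refl (horner-cong m (λ n → f≈g (suc n))))

  compose-cong : ∀ {f g} → f ≈PS g → compose f ≈PS compose g
  compose-cong f≈g n = horner-cong (suc n) f≈g n

  horner-⊕ : ∀ m f g → horner m (f ⊕ g) ≈PS (horner m f ⊕ horner m g)
  horner-⊕ zero f g = S.sym (S.+-identityˡ 𝟘)
  horner-⊕ (suc m) f g = SR.begin
    const (f 0 + g 0) ⊕ (s ⊛ horner m (tail f ⊕ tail g))
      SR.≈⟨ S.+-cong (const-+ (f 0) (g 0)) (⊛-cong {s} S.refl (horner-⊕ m (tail f) (tail g))) ⟩
    (const (f 0) ⊕ const (g 0)) ⊕ (s ⊛ (horner m (tail f) ⊕ horner m (tail g)))
      SR.≈⟨ S.solve 5 (λ a b s x y → (a S.:+ b) S.:+ s S.:* (x S.:+ y)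
                                   S.:= (a S.:+ s S.:* x) S.:+ (b S.:+ s S.:* y))
               S.refl (const (f 0)) (const (g 0)) s (horner m (tail f)) (horner m (tail g)) ⟩
    horner (suc m) f ⊕ horner (suc m) g SR.∎

  horner-· : ∀ m a f → horner m (a · f) ≈PS (const a ⊛ horner m f)
  horner-· zero a f = S.sym (S.zeroʳ (const a))
  horner-· (suc m) a f = SR.begin
    const (a * f 0) ⊕ (s ⊛ horner m (a · tail f))
      SR.≈⟨ S.+-cong (const-* a (f 0)) (⊛-cong {s} S.refl (horner-· m a (tail f))) ⟩
    (const a ⊛ const (f 0)) ⊕ (s ⊛ (const a ⊛ horner m (tail f)))
      SR.≈⟨ S.solve 4 (λ a b s x → a S.:* b S.:+ s S.:* (a S.:* x)
                                 S.:= a S.:* (b S.:+ s S.:* x))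
               S.refl (const a) (const (f 0)) s (horner m (tail f)) ⟩
    const a ⊛ horner (suc m) f SR.∎

  compose-⊕ : ∀ f g → compose (f ⊕ g) ≈PS (compose f ⊕ compose g)
  compose-⊕ f g n = horner-⊕ (suc n) f g n

  compose-· : ∀ a f → compose (a · f) ≈PS (const a ⊛ compose f)
  compose-· a f n = begin
    compose (a · f) n                 ≈⟨ horner-· (suc n) a f n ⟩
    (const a ⊛ horner (suc n) f) n    ≈⟨ const-⊛ a (horner (suc n) f) n ⟩
    a * compose f n                   ≈⟨ const-⊛ a (compose f) n ⟨
    (const a ⊛ compose f) n           ∎

  -- After one unfolding the tail of f g occurs multiplied by s, so multiplicativity is needed only
  -- at indices below n, but there for a new first factor. Hence the induction on a bound N with f
  -- and g left general.
  compose-⊛-below : ∀ N n → n < N → ∀ f g → compose (f ⊛ g) n ≈ (compose f ⊛ compose g) n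
  compose-⊛-below (suc N) n (s≤s n≤N) f g = begin
    compose (f ⊛ g) n
      ≈⟨ compose-unfold (f ⊛ g) n ⟩
    const ((f ⊛ g) 0) n + (s ⊛ compose (tail (f ⊛ g))) n
      ≈⟨ +-cong (const-cong (⊛-zero f g) n) (⊛-agree n (compose (tail (f ⊛ g))) step below) ⟩
    const (f 0 * g 0) n + (s ⊛ step) n
      ≈⟨ +-congʳ (const-* (f 0) (g 0) n) ⟩
    ((const (f 0) ⊛ const (g 0)) ⊕ (s ⊛ step)) n
      ≈⟨ S.solve 6 (λ a b s x y z → a S.:* b S.:+ s S.:* (a S.:* x S.:+ y S.:* z)
                        S.:= a S.:* (b S.:+ s S.:* x) S.:+ s S.:* y S.:* z)
           S.refl (const (f 0)) (const (g 0)) s (compose (tail g)) (compose (tail f)) (compose g) n ⟩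
    ((const (f 0) ⊛ (const (g 0) ⊕ (s ⊛ compose (tail g)))) ⊕ ((s ⊛ compose (tail f)) ⊛ compose g)) n
      ≈⟨ +-congʳ (⊛-cong {const (f 0)} S.refl (compose-unfold g) n) ⟨
    ((const (f 0) ⊛ compose g) ⊕ ((s ⊛ compose (tail f)) ⊛ compose g)) n
      ≈⟨ ⊛-distribʳ (compose g) (const (f 0)) (s ⊛ compose (tail f)) n ⟨
    ((const (f 0) ⊕ (s ⊛ compose (tail f))) ⊛ compose g) n
      ≈⟨ ⊛-cong {g = compose g} (compose-unfold f) S.refl n ⟨
    (compose f ⊛ compose g) n ∎
    where
    step = (const (f 0) ⊛ compose (tail g)) ⊕ (compose (tail f) ⊛ compose g)
    below : ∀ i → i < n → compose (tail (f ⊛ g)) i ≈ step i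
    below i i<n = begin
      compose (tail (f ⊛ g)) i
        ≈⟨ compose-cong (⊛-suc f g) i ⟩
      compose ((f 0 · tail g) ⊕ (tail f ⊛ g)) i
        ≈⟨ compose-⊕ (f 0 · tail g) (tail f ⊛ g) i ⟩
      compose (f 0 · tail g) i + compose (tail f ⊛ g) i
        ≈⟨ +-cong (compose-· (f 0) (tail g) i)
                  (compose-⊛-below N i (ℕ.<-≤-trans i<n n≤N) (tail f) g) ⟩
      step i ∎

  compose-⊛ : ∀ f g → compose (f ⊛ g) ≈PS (compose f ⊛ compose g)
  compose-⊛ f g n = compose-⊛-below (suc n) n ℕ.≤-refl f g

  horner-0 : ∀ m f → (∀ n → f n ≈ 0#) → horner m f ≈PS 𝟘
  horner-0 zero f f≈0 = S.refl
  horner-0 (suc m) f f≈0 = S.trans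
    (S.+-cong (S.trans (const-cong (f≈0 0)) (λ { zero → refl ; (suc n) → refl }))
              (S.trans (⊛-cong {s} S.refl (horner-0 m (tail f) (λ n → f≈0 (suc n)))) (S.zeroʳ s)))
    (S.+-identityˡ 𝟘)

  compose-const : ∀ a → compose (const a) ≈PS const a
  compose-const a = S.trans (compose-unfold (const a)) (S.trans
    (S.+-congˡ {const a} (S.trans (⊛-cong {s} S.refl tail≈0) (S.zeroʳ s)))
    (S.+-identityʳ (const a)))
    where
    tail≈0 : compose (tail (const a)) ≈PS 𝟘
    tail≈0 n = horner-0 (suc n) (tail (const a)) (λ _ → refl) n

  compose-X : compose X ≈PS s
  compose-X = SR.begin
    compose X                          SR.≈⟨ compose-unfold X ⟩
    const 0# ⊕ (s ⊛ compose (tail X))  SR.≈⟨ S.+-identityˡ (s ⊛ compose (tail X)) ⟩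
    s ⊛ compose (tail X)               SR.≈⟨ ⊛-cong {s} S.refl (compose-cong tail-X) ⟩
    s ⊛ compose 𝟙                      SR.≈⟨ ⊛-cong {s} S.refl (compose-const 1#) ⟩
    s ⊛ 𝟙                              SR.≈⟨ S.*-identityʳ s ⟩
    s                                  SR.∎

  compose-isRingHomomorphism : IsRingHomomorphism S.rawRing S.rawRing compose
  compose-isRingHomomorphism = Homomorphism.isRingHomomorphism seriesRing seriesRing
    compose compose-cong compose-⊕ compose-⊛ (compose-const 1#)

  open HomomorphismPowers seriesRing seriesRing compose compose-isRingHomomorphism public
    using () renaming (^-homo to ^-compose; powerQuotient-homo to powerQuotient-compose;
                       minus-homo to minus-compose)

  compose-lin : ∀ a → compose (lin a) ≈PS (𝟙 ⊝ (const a ⊛ s))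
  compose-lin a = SR.begin
    compose (lin a)
      SR.≈⟨ compose-cong (lin≈ a) ⟩
    compose (𝟙 ⊝ (const a ⊛ X))
      SR.≈⟨ minus-compose 𝟙 (const a ⊛ X) ⟩
    compose 𝟙 ⊝ compose (const a ⊛ X)
      SR.≈⟨ S.+-cong (compose-const 1#) (S.-‿cong (S.trans (compose-⊛ (const a) X)
              (⊛-cong (compose-const a) compose-X))) ⟩
    𝟙 ⊝ (const a ⊛ s) SR.∎

-- Inverses of series with constant term 1.

module SeriesInverse {c ℓ} (R : CommutativeRing c ℓ) where
  open CommutativeRing R hiding (zero)
  open PowerSeries R
  open Series R
  open SeriesProperties R
  import Relation.Binary.Reasoning.Setoid S.setoid as SR

  -- f = 1 − s is lin 1 composed with s, so its inverse is the geometric series in s.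
  inverse : ∀ f → f 0 ≈ 1# → Σ PS λ g → (f ⊛ g) ≈PS 𝟙
  inverse f f0≈1 = compose (geom 1#) , (SR.begin
    f ⊛ compose (geom 1#)
      SR.≈⟨ ⊛-cong {g = compose (geom 1#)} f≈ S.refl ⟩
    compose (lin 1#) ⊛ compose (geom 1#)
      SR.≈⟨ compose-⊛ (lin 1#) (geom 1#) ⟨
    compose (lin 1# ⊛ geom 1#)
      SR.≈⟨ compose-cong (lin-⊛-geom 1#) ⟩
    compose 𝟙
      SR.≈⟨ compose-const 1# ⟩
    𝟙 SR.∎)
    where
    open Composition R (𝟙 ⊝ f) (trans (+-congˡ (-‿cong f0≈1)) (-‿inverseʳ 1#))
    f≈ : f ≈PS compose (lin 1#)
    f≈ = S.trans
      (S.solve 1 (λ f → f S.:= S.:1 S.:- (S.:1 S.:* (S.:1 S.:- f))) S.refl f)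
      (S.sym (compose-lin 1#))

-- Invariance of residues under substitution.

TorsionFree : ∀ {c ℓ} → CommutativeRing c ℓ → Set (c ⊔ ℓ)
TorsionFree R = ∀ n x → natᶜ (suc n) * x ≈ 0# → x ≈ 0#
  where
  open CommutativeRing R
  open PowerSeries R

module Residue {c ℓ} (R : CommutativeRing c ℓ)
  (natᶜ-regular : TorsionFree R)
  (s u : PowerSeries.PS R)
  (s0≈0 : CommutativeRing._≈_ R (s 0) (CommutativeRing.0# R))
  (u-inverse : PowerSeries._≈PS_ R
     (PowerSeries._⊛_ R u (λ n → s (suc n))) (PowerSeries.𝟙 R)) where
  open CommutativeRing R hiding (zero)
  open PowerSeries R
  open Series R
  open SeriesProperties R
  open Composition R s s0≈0
  open IntegerSolver R
  open import Relation.Binary.Reasoning.Setoid setoid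
  import Relation.Binary.Reasoning.Setoid S.setoid as SR

  v w : PS
  v = tail s
  w = v ⊕ θ v

  θu⊛v : ((θ u ⊛ v) ⊕ (u ⊛ θ v)) ≈PS 𝟘
  θu⊛v = S.trans (S.sym (θ-⊛ u v)) (S.trans (θ-cong u-inverse) (θ-const 1#))

  us≈X : (u ⊛ s) ≈PS X
  us≈X = SR.begin
    u ⊛ s          SR.≈⟨ ⊛-cong {u} S.refl (X⊛-tail s s0≈0) ⟩
    u ⊛ (X ⊛ v)    SR.≈⟨ S.solve 3 (λ u x v → u S.:* (x S.:* v) S.:= x S.:* (u S.:* v)) S.refl u X v ⟩
    X ⊛ (u ⊛ v)    SR.≈⟨ ⊛-cong {X} S.refl u-inverse ⟩
    X ⊛ 𝟙          SR.≈⟨ S.*-identityʳ X ⟩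
    X              SR.∎

  -- This is X d/dX applied to s^(-M) = X^(-M) u^M, with X^(-M) cleared: the chain rule gives -M
  -- u^(M+1) w, the product rule gives θ(u^M) - M u^M.
  natᶜ-u^w : ∀ M → ((const (natᶜ M) ⊛ ((u S.^ suc M) ⊛ w)) ⊕ θ (u S.^ M))
                   ≈PS (const (natᶜ M) ⊛ (u S.^ M))
  natᶜ-u^w M = SR.begin
    (k ⊛ ((u ⊛ p) ⊛ (v ⊕ θ v))) ⊕ θ p
      SR.≈⟨ S.+-congˡ {k ⊛ ((u ⊛ p) ⊛ (v ⊕ θ v))} θp ⟩
    (k ⊛ ((u ⊛ p) ⊛ (v ⊕ θ v))) ⊕ (v ⊛ (k ⊛ (p ⊛ θ u)))
      SR.≈⟨ S.solve 6 (λ k u p v t tu →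
               k S.:* ((u S.:* p) S.:* (v S.:+ t)) S.:+ v S.:* (k S.:* (p S.:* tu))
               S.:= (k S.:* p) S.:* (u S.:* v) S.:+ (k S.:* p) S.:* (tu S.:* v S.:+ u S.:* t))
            S.refl k u p v (θ v) (θ u) ⟩
    ((k ⊛ p) ⊛ (u ⊛ v)) ⊕ ((k ⊛ p) ⊛ ((θ u ⊛ v) ⊕ (u ⊛ θ v)))
      SR.≈⟨ S.+-cong (⊛-cong {k ⊛ p} S.refl u-inverse) (⊛-cong {k ⊛ p} S.refl θu⊛v) ⟩
    ((k ⊛ p) ⊛ 𝟙) ⊕ ((k ⊛ p) ⊛ 𝟘)
      SR.≈⟨ S.solve 1 (λ x → x S.:* S.:1 S.:+ x S.:* S.:0 S.:= x) S.refl (k ⊛ p) ⟩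
    k ⊛ p SR.∎
    where
    k = const (natᶜ M)
    p = u S.^ M
    -- The power rule is available only for u θ(u^M), so the factor 1 = u v is inserted first.
    θp : θ p ≈PS (v ⊛ (k ⊛ (p ⊛ θ u)))
    θp = SR.begin
      θ p               SR.≈⟨ S.*-identityˡ (θ p) ⟨
      𝟙 ⊛ θ p           SR.≈⟨ ⊛-cong {g = θ p} u-inverse S.refl ⟨
      (u ⊛ v) ⊛ θ p     SR.≈⟨ S.solve 3 (λ u v t → (u S.:* v) S.:* t S.:= v S.:* (u S.:* t))
                                S.refl u v (θ p) ⟩
      v ⊛ (u ⊛ θ p)     SR.≈⟨ ⊛-cong {v} S.refl (⊛-θ-^ u M) ⟩
      v ⊛ (k ⊛ (p ⊛ θ u)) SR.∎

  -- The coefficient is the residue of s^(-M-2) ds, which is exact up to the factor M + 1. At index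
  -- `suc M` the operator θ multiplies by exactly the constant on the right of `natᶜ-u^w`, so both
  -- cancel; torsion-freeness removes the factor.
  u^w-vanishes : ∀ M → ((u S.^ suc (suc M)) ⊛ w) (suc M) ≈ 0#
  u^w-vanishes M = natᶜ-regular M _ (begin
    k * x                       ≈⟨ solve 2 (λ x y → x := (x :+ y) :- y) refl (k * x) (k * y) ⟩
    (k * x + k * y) - k * y     ≈⟨ +-congʳ (+-congʳ (const-⊛ k ((u S.^ suc (suc M)) ⊛ w) (suc M))) ⟨
    _                           ≈⟨ +-congʳ (natᶜ-u^w (suc M) (suc M)) ⟩
    (const k ⊛ (u S.^ suc M)) (suc M) - k * y
                                ≈⟨ +-congʳ (const-⊛ k (u S.^ suc M) (suc M)) ⟩
    k * y - k * y               ≈⟨ -‿inverseʳ _ ⟩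
    0#                          ∎)
    where
    k = natᶜ (suc M)
    x = ((u S.^ suc (suc M)) ⊛ w) (suc M)
    y = (u S.^ suc M) (suc M)

  -- Res F(s) s^{-M-1} ds = Res F(t) t^{-M-1} dt: here u = X/s and w = ds/dX.
  residue : ∀ M F → (compose F ⊛ ((u S.^ suc M) ⊛ w)) M ≈ F M
  residue M F = begin
    (compose F ⊛ (u^ ⊛ w)) M
      ≈⟨ ⊛-cong {g = u^ ⊛ w} (compose-unfold F) S.refl M ⟩
    ((const (F 0) ⊕ (s ⊛ F′)) ⊛ (u^ ⊛ w)) M
      ≈⟨ S.solve 6 (λ f s g u p w →
               (f S.:+ s S.:* g) S.:* ((u S.:* p) S.:* w)
               S.:= f S.:* ((u S.:* p) S.:* w) S.:+ (u S.:* s) S.:* (g S.:* (p S.:* w)))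
             S.refl (const (F 0)) s F′ u (u S.^ M) w M ⟩
    (const (F 0) ⊛ (u^ ⊛ w)) M + ((u ⊛ s) ⊛ (F′ ⊛ ((u S.^ M) ⊛ w))) M
      ≈⟨ +-cong (const-⊛ (F 0) (u^ ⊛ w) M) (⊛-cong {g = F′ ⊛ ((u S.^ M) ⊛ w)} us≈X S.refl M) ⟩
    F 0 * (u^ ⊛ w) M + (X ⊛ (F′ ⊛ ((u S.^ M) ⊛ w))) M
      ≈⟨ last M ⟩
    F M ∎
    where
    u^ = u S.^ suc M
    F′ = compose (tail F)
    -- F(0) contributes only for M = 0, where it meets the residue 1 of ds/s. In the rest u s = X
    -- has used up one power of u, which is the claim for the tail of F at the next lower index.
    last : ∀ M → F 0 * ((u S.^ suc M) ⊛ w) M + (X ⊛ (F′ ⊛ ((u S.^ M) ⊛ w))) M ≈ F M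
    last zero = begin
      F 0 * ((u ⊛ 𝟙) ⊛ w) 0 + (X ⊛ (F′ ⊛ (𝟙 ⊛ w))) 0
        ≈⟨ +-cong (*-congˡ uw0) (X⊛-zero (F′ ⊛ (𝟙 ⊛ w))) ⟩
      F 0 * 1# + 0#
        ≈⟨ trans (+-identityʳ _) (*-identityʳ _) ⟩
      F 0 ∎
      where
      uw0 : ((u ⊛ 𝟙) ⊛ w) 0 ≈ 1#
      uw0 = begin
        ((u ⊛ 𝟙) ⊛ w) 0             ≈⟨ ⊛-zero (u ⊛ 𝟙) w ⟩
        (u ⊛ 𝟙) 0 * (v 0 + 0# * v 0) ≈⟨ *-congʳ (⊛-zero u 𝟙) ⟩
        u 0 * 1# * (v 0 + 0# * v 0) ≈⟨ solve 2 (λ u v → u :* :1 :* (v :+ :0 :* v) := u :* v) refl (u 0) (v 0) ⟩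
        u 0 * v 0                   ≈⟨ ⊛-zero u v ⟨
        (u ⊛ v) 0                   ≈⟨ u-inverse 0 ⟩
        1#                          ∎
    last (suc M) = begin
      F 0 * ((u S.^ suc (suc M)) ⊛ w) (suc M) + (X ⊛ (F′ ⊛ ((u S.^ suc M) ⊛ w))) (suc M)
        ≈⟨ +-cong (*-congˡ (u^w-vanishes M)) (X⊛-suc (F′ ⊛ ((u S.^ suc M) ⊛ w)) M) ⟩
      F 0 * 0# + (F′ ⊛ ((u S.^ suc M) ⊛ w)) M
        ≈⟨ trans (+-congʳ (zeroʳ _)) (+-identityˡ _) ⟩
      (compose (tail F) ⊛ ((u S.^ suc M) ⊛ w)) M
        ≈⟨ residue M (tail F) ⟩
      F (suc M) ∎

-- The substitution X ↦ d X, and change of coefficients along a homomorphism.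

module Scaling {c ℓ} (R : CommutativeRing c ℓ) (d : CommutativeRing.Carrier R) where
  open CommutativeRing R hiding (zero)
  open PowerSeries R
  open Sums R
  open Series R
  open SeriesProperties R
  open IntegerSolver R
  open Powers R
  open import Relation.Binary.Reasoning.Setoid setoid

  scale : PS → PS
  scale f n = d ^ n * f n

  scale-cong : ∀ {f g} → f ≈PS g → scale f ≈PS scale g
  scale-cong f≈g n = *-congˡ (f≈g n)

  scale-⊛ : ∀ f g → scale (f ⊛ g) ≈PS (scale f ⊛ scale g)
  scale-⊛ f g n = trans (*-sumUpTo (suc n) (d ^ n) (λ i → f i * g (n ∸ i)))
    (sumUpTo-cong (suc n) λ i i≤n → begin
      d ^ n * (f i * g (n ∸ i))
        ≡⟨ ≡.cong (λ k → d ^ k * (f i * g (n ∸ i))) (ℕ.m+[n∸m]≡n (ℕ.≤-pred i≤n)) ⟨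
      d ^ (i ℕ.+ (n ∸ i)) * (f i * g (n ∸ i))
        ≈⟨ *-congʳ (^-homo-* d i (n ∸ i)) ⟩
      d ^ i * d ^ (n ∸ i) * (f i * g (n ∸ i))
        ≈⟨ solve 4 (λ a b x y → a :* b :* (x :* y) := (a :* x) :* (b :* y))
             refl (d ^ i) (d ^ (n ∸ i)) (f i) (g (n ∸ i)) ⟩
      (d ^ i * f i) * (d ^ (n ∸ i) * g (n ∸ i)) ∎)

  scale-1 : scale 𝟙 ≈PS 𝟙
  scale-1 zero = *-identityˡ 1#
  scale-1 (suc n) = zeroʳ _

  scale-isRingHomomorphism : IsRingHomomorphism S.rawRing S.rawRing scale
  scale-isRingHomomorphism = Homomorphism.isRingHomomorphism seriesRing seriesRing
    scale scale-cong (λ f g n → distribˡ _ _ _) scale-⊛ scale-1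

  scale-X^ : ∀ r → d ^ r ≈ 1# → scale (X S.^ r) ≈PS (X S.^ r)
  scale-X^ r d^r≈1 n with n ℕ.≟ r
  ... | yes ≡.refl = trans (*-congʳ d^r≈1) (*-identityˡ _)
  ... | no n≢r = trans (*-congˡ (X^-other r n n≢r)) (trans (zeroʳ _) (sym (X^-other r n n≢r)))

  θ-scale : ∀ f → θ (scale f) ≈PS scale (θ f)
  θ-scale f n = solve 3 (λ k p x → k :* (p :* x) := p :* (k :* x)) refl (natᶜ n) (d ^ n) (f n)

module MapSeries {a ℓ₁ b ℓ₂} (A : CommutativeRing a ℓ₁) (B : CommutativeRing b ℓ₂)
  (h : CommutativeRing.Carrier A → CommutativeRing.Carrier B)
  (hom : IsRingHomomorphism (CommutativeRing.rawRing A) (CommutativeRing.rawRing B) h) where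
  private
    module A where
      open CommutativeRing A public
      open PowerSeries A public
    module B where
      open CommutativeRing B public
      open PowerSeries B public
  open IsRingHomomorphism hom

  sumUpTo-homo : ∀ n f → h (A.sumUpTo n f) B.≈ B.sumUpTo n (h ∘ f)
  sumUpTo-homo zero f = 0#-homo
  sumUpTo-homo (suc n) f = B.trans (+-homo _ _) (B.+-congʳ (sumUpTo-homo n f))

  natᶜ-homo : ∀ n → h (A.natᶜ n) B.≈ B.natᶜ n
  natᶜ-homo zero = 0#-homo
  natᶜ-homo (suc n) = B.trans (+-homo _ _) (B.+-cong 1#-homo (natᶜ-homo n))

  map-X : (h ∘ A.X) B.≈PS B.X
  map-X zero = 0#-homo
  map-X (suc zero) = 1#-homo
  map-X (suc (suc n)) = 0#-homo

  map-lin : ∀ x → (h ∘ A.lin x) B.≈PS B.lin (h x)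
  map-lin x zero = 1#-homo
  map-lin x (suc zero) = -‿homo x
  map-lin x (suc (suc n)) = 0#-homo

  map-⊛ : ∀ f g → (h ∘ (f A.⊛ g)) B.≈PS ((h ∘ f) B.⊛ (h ∘ g))
  map-⊛ f g n = B.trans (sumUpTo-homo (suc n) (λ i → f i A.* g (n ∸ i)))
    (Sums.sumUpTo-cong B (suc n) (λ i _ → *-homo (f i) (g (n ∸ i))))

  map-1 : (h ∘ A.𝟙) B.≈PS B.𝟙
  map-1 zero = 1#-homo
  map-1 (suc n) = 0#-homo

  map-isRingHomomorphism : IsRingHomomorphism
    (CommutativeRing.rawRing (Series.seriesRing A)) (CommutativeRing.rawRing (Series.seriesRing B)) (h ∘_)
  map-isRingHomomorphism = Homomorphism.isRingHomomorphism
    (Series.seriesRing A) (Series.seriesRing B) (h ∘_)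
    (λ f≈g n → ⟦⟧-cong (f≈g n)) (λ f g n → +-homo _ _) map-⊛ map-1

-- The integrand without its denominators.

module Integrand {c ℓ} (R : CommutativeRing c ℓ) where
  open CommutativeRing R hiding (zero)
  open PowerSeries R
  open Series R
  open SeriesProperties R
  open IntegerSolver R
  import Relation.Binary.Reasoning.Setoid S.setoid as SR

  -- `trIntegrand` over an arbitrary ring; over ℚ the two agree by unfolding, so `integrand≈`
  -- applies there directly.
  integrand : ℕ → ℕ → PS
  integrand k r =
    ((((lin 1# ^^ suc r) ⊝ (X ^^ suc r)) ^^ k) ⊛ (geom 1# ^^ (r ℕ.* k)))
      ⊛ linPowℤ two ((+ 2) ℤ.- (+ k))

  -- Read as 1 - 2t = (1 - t) - t, this identifies the divisor in the definition of P_r with the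
  -- difference a - b of `powerQuotient`.
  lin-two : lin two ≈PS (lin 1# ⊝ X)
  lin-two zero = solve 0 (:1 := :1 :- :0) refl
  lin-two (suc zero) = solve 0 (:- (:1 :+ :1) := :- :1 :- :1) refl
  lin-two (suc (suc n)) = solve 0 (:0 := :0 :- :0) refl

  numerator≈ : ∀ r → ((lin 1# ^^ suc r) ⊝ (X ^^ suc r))
                     ≈PS (lin two ⊛ S.powerQuotient r (lin 1#) X)
  numerator≈ r = SR.begin
    (lin 1# ^^ suc r) ⊝ (X ^^ suc r)
      SR.≈⟨ S.+-cong (^^≈^ (lin 1#) (suc r)) (S.-‿cong (^^≈^ X (suc r))) ⟩
    (lin 1# S.^ suc r) ⊝ (X S.^ suc r)
      SR.≈⟨ S.*-powerQuotient r (lin 1#) X ⟨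
    (lin 1# ⊝ X) ⊛ S.powerQuotient r (lin 1#) X
      SR.≈⟨ ⊛-cong {g = S.powerQuotient r (lin 1#) X} lin-two S.refl ⟨
    lin two ⊛ S.powerQuotient r (lin 1#) X SR.∎

  lin^-⊛-geom^ : ∀ a m → ((lin a S.^ m) ⊛ (geom a S.^ m)) ≈PS 𝟙
  lin^-⊛-geom^ a m = SR.begin
    (lin a S.^ m) ⊛ (geom a S.^ m) SR.≈⟨ S.^-distrib-* (lin a) (geom a) m ⟨
    (lin a ⊛ geom a) S.^ m         SR.≈⟨ S.^-congˡ m (lin-⊛-geom a) ⟩
    𝟙 S.^ m                        SR.≈⟨ S.1^ m ⟩
    𝟙                              SR.∎

  -- The integer exponent computes only after splitting k into 0, 1 and j + 2, where it is 1, 0 and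
  -- -(j+1); the last case goes through the geometric series.
  lin^-⊛-linPowℤ : ∀ a k → ((lin a S.^ suc k) ⊛ linPowℤ a ((+ 2) ℤ.- (+ suc k))) ≈PS (lin a S.^ 2)
  lin^-⊛-linPowℤ a zero =
    S.solve 1 (λ l → l S.:* S.:1 S.:* (l S.:* S.:1) S.:= l S.:* (l S.:* S.:1)) S.refl (lin a)
  lin^-⊛-linPowℤ a (suc zero) = S.*-identityʳ _
  lin^-⊛-linPowℤ a (suc (suc j)) = SR.begin
    (lin a ⊛ (lin a ⊛ l)) ⊛ (geom a ^^ suc j)
      SR.≈⟨ ⊛-cong {lin a ⊛ (lin a ⊛ l)} S.refl (^^≈^ (geom a) (suc j)) ⟩
    (lin a ⊛ (lin a ⊛ l)) ⊛ g
      SR.≈⟨ S.solve 3 (λ x l g → x S.:* (x S.:* l) S.:* g S.:= x S.:* (x S.:* S.:1) S.:* (l S.:* g))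
               S.refl (lin a) l g ⟩
    (lin a S.^ 2) ⊛ (l ⊛ g)
      SR.≈⟨ ⊛-cong {lin a S.^ 2} S.refl (lin^-⊛-geom^ a (suc j)) ⟩
    (lin a S.^ 2) ⊛ 𝟙
      SR.≈⟨ S.*-identityʳ (lin a S.^ 2) ⟩
    lin a S.^ 2 SR.∎
    where
    l = lin a S.^ suc j
    g = geom a S.^ suc j

  -- Every factor 1 - 2t from the numerator meets the power of 1 - 2t in the integrand, and exactly
  -- two survive. The pole in t is absent because the coefficient index in `tr` accounts for it.
  integrand≈ : ∀ k r → (integrand (suc k) r ⊛ (lin 1# S.^ (r ℕ.* suc k)))
                       ≈PS ((S.powerQuotient r (lin 1#) X S.^ suc k) ⊛ (lin two S.^ 2))
  integrand≈ k r = SR.begin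
    (((n ^^ suc k) ⊛ (geom 1# ^^ (r ℕ.* suc k))) ⊛ L) ⊛ l
      SR.≈⟨ ⊛-cong {g = l} (⊛-cong {g = L}
              (⊛-cong (^^≈^ n (suc k)) (^^≈^ (geom 1#) (r ℕ.* suc k))) S.refl) S.refl ⟩
    (((n S.^ suc k) ⊛ g) ⊛ L) ⊛ l
      SR.≈⟨ S.solve 4 (λ n g L l → n S.:* g S.:* L S.:* l S.:= n S.:* L S.:* (l S.:* g))
               S.refl (n S.^ suc k) g L l ⟩
    ((n S.^ suc k) ⊛ L) ⊛ (l ⊛ g)
      SR.≈⟨ ⊛-cong {(n S.^ suc k) ⊛ L} S.refl (lin^-⊛-geom^ 1# (r ℕ.* suc k)) ⟩
    ((n S.^ suc k) ⊛ L) ⊛ 𝟙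
      SR.≈⟨ S.*-identityʳ ((n S.^ suc k) ⊛ L) ⟩
    (n S.^ suc k) ⊛ L
      SR.≈⟨ ⊛-cong {g = L} n^ S.refl ⟩
    ((lin two S.^ suc k) ⊛ (q S.^ suc k)) ⊛ L
      SR.≈⟨ S.solve 3 (λ x q L → x S.:* q S.:* L S.:= q S.:* (x S.:* L))
               S.refl (lin two S.^ suc k) (q S.^ suc k) L ⟩
    (q S.^ suc k) ⊛ ((lin two S.^ suc k) ⊛ L)
      SR.≈⟨ ⊛-cong {q S.^ suc k} S.refl (lin^-⊛-linPowℤ two k) ⟩
    (q S.^ suc k) ⊛ (lin two S.^ 2) SR.∎
    where
    n = (lin 1# ^^ suc r) ⊝ (X ^^ suc r)
    q = S.powerQuotient r (lin 1#) X
    g = geom 1# S.^ (r ℕ.* suc k)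
    l = lin 1# S.^ (r ℕ.* suc k)
    L = linPowℤ two ((+ 2) ℤ.- (+ suc k))
    n^ : (n S.^ suc k) ≈PS ((lin two S.^ suc k) ⊛ (q S.^ suc k))
    n^ = S.trans (S.^-congˡ (suc k) (numerator≈ r)) (S.^-distrib-* (lin two) q (suc k))

-- Evaluation of polynomials at a series and implicit differentiation.

module Evaluation {c ℓ} (R : CommutativeRing c ℓ) (s : PowerSeries.PS R) where
  private module R = CommutativeRing R
  open PowerSeries R
  open Series R
  open SeriesProperties R
  open S using (solve; _:=_; _:+_; _:*_; :-_; _:-_; :0; :1)
  open import Relation.Binary.Reasoning.Setoid S.setoid

  ev : Poly → PS
  ev p = evalP p s

  ev-+ : ∀ p q → ev (p +P q) ≈PS (ev p ⊕ ev q)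
  ev-+ [] q = S.sym (S.+-identityˡ (ev q))
  ev-+ (a ∷ p) [] = S.sym (S.+-identityʳ (ev (a ∷ p)))
  ev-+ (a ∷ p) (b ∷ q) = begin
    (a ⊕ b) ⊕ (s ⊛ ev (p +P q))
      ≈⟨ S.+-congˡ {a ⊕ b} (⊛-cong {s} S.refl (ev-+ p q)) ⟩
    (a ⊕ b) ⊕ (s ⊛ (ev p ⊕ ev q))
      ≈⟨ solve 5 (λ a b s p q → (a :+ b) :+ s :* (p :+ q) := (a :+ s :* p) :+ (b :+ s :* q))
           S.refl a b s (ev p) (ev q) ⟩
    ev (a ∷ p) ⊕ ev (b ∷ q) ∎

  ev-scale : ∀ a p → ev (scaleP a p) ≈PS (a ⊛ ev p)
  ev-scale a [] = S.sym (S.zeroʳ a)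
  ev-scale a (b ∷ p) = begin
    (a ⊛ b) ⊕ (s ⊛ ev (scaleP a p))
      ≈⟨ S.+-congˡ {a ⊛ b} (⊛-cong {s} S.refl (ev-scale a p)) ⟩
    (a ⊛ b) ⊕ (s ⊛ (a ⊛ ev p))
      ≈⟨ solve 4 (λ a b s p → a :* b :+ s :* (a :* p) := a :* (b :+ s :* p))
           S.refl a b s (ev p) ⟩
    a ⊛ ev (b ∷ p) ∎

  ev-* : ∀ p q → ev (p *P q) ≈PS (ev p ⊛ ev q)
  ev-* [] q = S.sym (S.zeroˡ (ev q))
  ev-* (a ∷ p) q = begin
    ev (scaleP a q +P (𝟘 ∷ (p *P q)))
      ≈⟨ ev-+ (scaleP a q) (𝟘 ∷ (p *P q)) ⟩
    ev (scaleP a q) ⊕ (𝟘 ⊕ (s ⊛ ev (p *P q)))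
      ≈⟨ S.+-cong (ev-scale a q) (S.+-congˡ {𝟘} (⊛-cong {s} S.refl (ev-* p q))) ⟩
    (a ⊛ ev q) ⊕ (𝟘 ⊕ (s ⊛ (ev p ⊛ ev q)))
      ≈⟨ solve 4 (λ a s p q → a :* q :+ (:0 :+ s :* (p :* q)) := (a :+ s :* p) :* q)
           S.refl a s (ev p) (ev q) ⟩
    ev (a ∷ p) ⊛ ev q ∎

  ev-neg : ∀ p → ev (negP p) ≈PS (⊖ ev p)
  ev-neg [] = solve 0 (:0 := :- :0) S.refl
  ev-neg (a ∷ p) = begin
    (⊖ a) ⊕ (s ⊛ ev (negP p))
      ≈⟨ S.+-congˡ {⊖ a} (⊛-cong {s} S.refl (ev-neg p)) ⟩
    (⊖ a) ⊕ (s ⊛ (⊖ ev p))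
      ≈⟨ solve 3 (λ a s p → :- a :+ s :* (:- p) := :- (a :+ s :* p)) S.refl a s (ev p) ⟩
    ⊖ ev (a ∷ p) ∎

  ev-minus : ∀ p q → ev (p -P q) ≈PS (ev p ⊝ ev q)
  ev-minus p q = S.trans (ev-+ p (negP q)) (S.+-congˡ {ev p} (ev-neg q))

  ev-constP : ∀ a → ev (constP a) ≈PS a
  ev-constP a = solve 2 (λ a s → a :+ s :* :0 := a) S.refl a s

  ev-t : ev tP ≈PS s
  ev-t = solve 1 (λ s → :0 :+ s :* (:1 :+ s :* :0) := s) S.refl s

  ev-^ : ∀ p n → ev (p ^P n) ≈PS (ev p S.^ n)
  ev-^ p zero = ev-constP 𝟙
  ev-^ p (suc n) = S.trans (ev-* p (p ^P n)) (⊛-cong {ev p} S.refl (ev-^ p n))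

  ev-oneMinusT : ev oneMinusT ≈PS (𝟙 ⊝ s)
  ev-oneMinusT = S.trans (ev-minus oneP tP) (S.+-cong (ev-constP 𝟙) (S.-‿cong ev-t))

  ev-sum : ∀ n f → ev (sumPUpTo n f) ≈PS PowerSeries.sumUpTo seriesRing n (λ i → ev (f i))
  ev-sum zero f = S.refl
  ev-sum (suc n) f = S.trans (ev-+ (sumPUpTo n f) (f n)) (S.+-cong (ev-sum n f) S.refl)

  ev-Qpoly : ∀ r → ev (Qpoly r) ≈PS S.powerQuotient r (𝟙 ⊝ s) s
  ev-Qpoly r = begin
    ev (Qpoly r)
      ≈⟨ ev-sum (suc r) (λ j → (oneMinusT ^P j) *P (tP ^P (r ∸ j))) ⟩
    PowerSeries.sumUpTo seriesRing (suc r) (λ j → ev ((oneMinusT ^P j) *P (tP ^P (r ∸ j))))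
      ≈⟨ Sums.sumUpTo-cong seriesRing (suc r) (λ j _ → term j (r ∸ j)) ⟩
    PowerSeries.sumUpTo seriesRing (suc r) (λ j → ((𝟙 ⊝ s) S.^ j) ⊛ (s S.^ (r ∸ j)))
      ≈⟨ S.powerQuotient-sum r (𝟙 ⊝ s) s ⟩
    S.powerQuotient r (𝟙 ⊝ s) s ∎
    where
    term : ∀ j i → ev ((oneMinusT ^P j) *P (tP ^P i)) ≈PS (((𝟙 ⊝ s) S.^ j) ⊛ (s S.^ i))
    term j i = S.trans (ev-* (oneMinusT ^P j) (tP ^P i))
      (⊛-cong (S.trans (ev-^ oneMinusT j) (S.^-congˡ j ev-oneMinusT))
              (S.trans (ev-^ tP i) (S.^-congˡ i ev-t)))

  ev-Ppoly : ∀ r x → ev (Ppoly r x) ≈PS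
    (((s S.^ r) ⊛ ((𝟙 ⊝ s) S.^ r)) ⊝ (x ⊛ S.powerQuotient r (𝟙 ⊝ s) s))
  ev-Ppoly r x = S.trans (ev-minus ((tP ^P r) *P (oneMinusT ^P r)) (constP x *P Qpoly r))
    (S.+-cong
      (S.trans (ev-* (tP ^P r) (oneMinusT ^P r))
        (⊛-cong (S.trans (ev-^ tP r) (S.^-congˡ r ev-t))
                (S.trans (ev-^ oneMinusT r) (S.^-congˡ r ev-oneMinusT))))
      (S.-‿cong (S.trans (ev-* (constP x) (Qpoly r))
        (⊛-cong (ev-constP x) (ev-Qpoly r)))))

  -- Raising the initial weight by one adds one copy of every coefficient. This turns the
  -- weight-counting derivative into the product rule for a + t p in `ev-derivP-∷`.
  ev-derivAux-suc : ∀ k p → ev (derivAux (suc k) p) ≈PS (ev p ⊕ ev (derivAux k p))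
  ev-derivAux-suc k [] = S.sym (S.+-identityˡ 𝟘)
  ev-derivAux-suc k (b ∷ q) = begin
    (natᶜ (suc k) · b) ⊕ (s ⊛ ev (derivAux (suc (suc k)) q))
      ≈⟨ S.+-cong (λ n → R.trans (R.distribʳ (b n) R.1# (natᶜ k)) (R.+-congʳ (R.*-identityˡ (b n))))
                  (⊛-cong {s} S.refl (ev-derivAux-suc (suc k) q)) ⟩
    (b ⊕ (natᶜ k · b)) ⊕ (s ⊛ (ev q ⊕ ev (derivAux (suc k) q)))
      ≈⟨ solve 5 (λ b kb s q d → (b :+ kb) :+ s :* (q :+ d) := (b :+ s :* q) :+ (kb :+ s :* d))
           S.refl b (natᶜ k · b) s (ev q) (ev (derivAux (suc k) q)) ⟩
    ev (b ∷ q) ⊕ ev (derivAux k (b ∷ q)) ∎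

  ev-derivAux-0 : ∀ p → ev (derivAux 0 p) ≈PS (s ⊛ ev (derivP p))
  ev-derivAux-0 [] = S.sym (S.zeroʳ s)
  ev-derivAux-0 (b ∷ q) = S.trans
    (S.+-cong {natᶜ 0 · b} {𝟘} (λ n → R.trans (R.zeroˡ (b n)) (R.sym (𝟘≈0 n))) S.refl)
    (S.+-identityˡ (s ⊛ ev (derivAux 1 q)))

  ev-derivP-∷ : ∀ a p → ev (derivP (a ∷ p)) ≈PS (ev p ⊕ (s ⊛ ev (derivP p)))
  ev-derivP-∷ a p = S.trans (ev-derivAux-suc 0 p) (S.+-congˡ {ev p} (ev-derivAux-0 p))

  -- The chain rule for a polynomial whose coefficients depend on X as well: `map θ` differentiates
  -- the coefficients, `derivP` the variable t.
  θ-ev : ∀ p → θ (ev p) ≈PS (ev (map θ p) ⊕ (θ s ⊛ ev (derivP p)))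
  θ-ev [] = S.trans (θ-const R.0#) (solve 1 (λ t → :0 := :0 :+ t :* :0) S.refl (θ s))
  θ-ev (a ∷ p) = begin
    θ (a ⊕ (s ⊛ ev p))
      ≈⟨ θ-⊕ a (s ⊛ ev p) ⟩
    θ a ⊕ θ (s ⊛ ev p)
      ≈⟨ S.+-congˡ {θ a} (θ-⊛ s (ev p)) ⟩
    θ a ⊕ ((θ s ⊛ ev p) ⊕ (s ⊛ θ (ev p)))
      ≈⟨ S.+-congˡ {θ a} (S.+-congˡ {θ s ⊛ ev p} (⊛-cong {s} S.refl (θ-ev p))) ⟩
    θ a ⊕ ((θ s ⊛ ev p) ⊕ (s ⊛ (ev (map θ p) ⊕ (θ s ⊛ ev (derivP p)))))
      ≈⟨ solve 6 (λ a t p s m d → a :+ (t :* p :+ s :* (m :+ t :* d))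
                                := (a :+ s :* m) :+ t :* (p :+ s :* d))
           S.refl (θ a) (θ s) (ev p) s (ev (map θ p)) (ev (derivP p)) ⟩
    ev (map θ (a ∷ p)) ⊕ (θ s ⊛ (ev p ⊕ (s ⊛ ev (derivP p))))
      ≈⟨ S.+-congˡ {ev (map θ (a ∷ p))} (⊛-cong {θ s} S.refl (ev-derivP-∷ a p)) ⟨
    ev (map θ (a ∷ p)) ⊕ (θ s ⊛ ev (derivP (a ∷ p))) ∎

  Constant : Poly → Set _
  Constant = All (λ a → θ a ≈PS 𝟘)

  ev-map-θ-constant : ∀ {p} → Constant p → ev (map θ p) ≈PS 𝟘
  ev-map-θ-constant [] = S.refl
  ev-map-θ-constant (θa≈0 ∷ cs) = S.trans
    (S.+-cong θa≈0 (⊛-cong {s} S.refl (ev-map-θ-constant cs)))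
    (solve 1 (λ s → :0 :+ s :* :0 := :0) S.refl s)

  θ-⊛-constant : ∀ {a b} → θ b ≈PS 𝟘 → θ (a ⊛ b) ≈PS (θ a ⊛ b)
  θ-⊛-constant {a} {b} θb≈0 = S.trans (θ-⊛ a b) (S.trans
    (S.+-congˡ {θ a ⊛ b} (⊛-cong {a} S.refl θb≈0))
    (solve 2 (λ x a → x :+ a :* :0 := x) S.refl (θ a ⊛ b) a))

  constant-+ : ∀ {p q} → Constant p → Constant q → Constant (p +P q)
  constant-+ [] cq = cq
  constant-+ (a ∷ cp) [] = a ∷ cp
  constant-+ (_∷_ {a} θa≈0 cp) (_∷_ {b} θb≈0 cq) =
    S.trans (θ-⊕ a b) (S.trans (S.+-cong θa≈0 θb≈0) (S.+-identityˡ 𝟘)) ∷ constant-+ cp cq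

  constant-scale : ∀ {a p} → θ a ≈PS 𝟘 → Constant p → Constant (scaleP a p)
  constant-scale θa≈0 [] = []
  constant-scale {a} θa≈0 (_∷_ {b} θb≈0 cp) =
    S.trans (θ-⊛-constant {a} θb≈0) (S.trans (⊛-cong {g = b} θa≈0 S.refl) (S.zeroˡ b))
    ∷ constant-scale θa≈0 cp

  constant-* : ∀ {p q} → Constant p → Constant q → Constant (p *P q)
  constant-* [] cq = []
  constant-* (θa≈0 ∷ cp) cq =
    constant-+ (constant-scale θa≈0 cq) (θ-const R.0# ∷ constant-* cp cq)

  constant-neg : ∀ {p} → Constant p → Constant (negP p)
  constant-neg [] = []
  constant-neg (_∷_ {a} θa≈0 cp) =
    S.trans (θ-⊖ a) (S.trans (S.-‿cong θa≈0) (solve 0 (:- :0 := :0) S.refl)) ∷ constant-neg cp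

  constant-one : Constant oneP
  constant-one = θ-const R.1# ∷ []

  constant-t : Constant tP
  constant-t = θ-const R.0# ∷ θ-const R.1# ∷ []

  constant-^ : ∀ {p} n → Constant p → Constant (p ^P n)
  constant-^ zero cp = constant-one
  constant-^ (suc n) cp = constant-* cp (constant-^ n cp)

  constant-oneMinusT : Constant oneMinusT
  constant-oneMinusT = constant-+ constant-one (constant-neg constant-t)

  constant-sum : ∀ n {f} → (∀ i → Constant (f i)) → Constant (sumPUpTo n f)
  constant-sum zero cf = []
  constant-sum (suc n) cf = constant-+ (constant-sum n cf) (cf n)

  constant-Qpoly : ∀ r → Constant (Qpoly r)
  constant-Qpoly r = constant-sum (suc r) λ j →
    constant-* (constant-^ j constant-oneMinusT) (constant-^ (r ∸ j) constant-t)

  ev-map-θ-+ : ∀ p q → ev (map θ (p +P q)) ≈PS (ev (map θ p) ⊕ ev (map θ q))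
  ev-map-θ-+ [] q = S.sym (S.+-identityˡ (ev (map θ q)))
  ev-map-θ-+ (a ∷ p) [] = S.sym (S.+-identityʳ (ev (map θ (a ∷ p))))
  ev-map-θ-+ (a ∷ p) (b ∷ q) = begin
    θ (a ⊕ b) ⊕ (s ⊛ ev (map θ (p +P q)))
      ≈⟨ S.+-cong (θ-⊕ a b) (⊛-cong {s} S.refl (ev-map-θ-+ p q)) ⟩
    (θ a ⊕ θ b) ⊕ (s ⊛ (ev (map θ p) ⊕ ev (map θ q)))
      ≈⟨ solve 5 (λ a b s p q → (a :+ b) :+ s :* (p :+ q) := (a :+ s :* p) :+ (b :+ s :* q))
           S.refl (θ a) (θ b) s (ev (map θ p)) (ev (map θ q)) ⟩
    ev (map θ (a ∷ p)) ⊕ ev (map θ (b ∷ q)) ∎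

  ev-map-θ-neg : ∀ p → ev (map θ (negP p)) ≈PS (⊖ ev (map θ p))
  ev-map-θ-neg [] = solve 0 (:0 := :- :0) S.refl
  ev-map-θ-neg (a ∷ p) = begin
    θ (⊖ a) ⊕ (s ⊛ ev (map θ (negP p)))
      ≈⟨ S.+-cong (θ-⊖ a) (⊛-cong {s} S.refl (ev-map-θ-neg p)) ⟩
    (⊖ θ a) ⊕ (s ⊛ (⊖ ev (map θ p)))
      ≈⟨ solve 3 (λ a s p → :- a :+ s :* (:- p) := :- (a :+ s :* p)) S.refl (θ a) s (ev (map θ p)) ⟩
    ⊖ ev (map θ (a ∷ p)) ∎

  ev-map-θ-scale : ∀ x {p} → Constant p → ev (map θ (scaleP x p)) ≈PS (θ x ⊛ ev p)
  ev-map-θ-scale x [] = S.sym (S.zeroʳ (θ x))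
  ev-map-θ-scale x (_∷_ {b} {p} θb≈0 cp) = begin
    θ (x ⊛ b) ⊕ (s ⊛ ev (map θ (scaleP x p)))
      ≈⟨ S.+-cong (θ-⊛-constant {x} θb≈0) (⊛-cong {s} S.refl (ev-map-θ-scale x cp)) ⟩
    (θ x ⊛ b) ⊕ (s ⊛ (θ x ⊛ ev p))
      ≈⟨ solve 4 (λ a b s p → a :* b :+ s :* (a :* p) := a :* (b :+ s :* p))
           S.refl (θ x) b s (ev p) ⟩
    θ x ⊛ ev (b ∷ p) ∎

  -- P_r is affine in x with all other coefficients killed by θ, so only the cofactor of x remains.
  ev-map-θ-Ppoly : ∀ r x → ev (map θ (Ppoly r x)) ≈PS (⊖ (θ x ⊛ S.powerQuotient r (𝟙 ⊝ s) s))
  ev-map-θ-Ppoly r x = begin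
    ev (map θ (A +P negP (constP x *P Qpoly r)))
      ≈⟨ ev-map-θ-+ A (negP (constP x *P Qpoly r)) ⟩
    ev (map θ A) ⊕ ev (map θ (negP (constP x *P Qpoly r)))
      ≈⟨ S.+-cong (ev-map-θ-constant constant-A) (ev-map-θ-neg (constP x *P Qpoly r)) ⟩
    𝟘 ⊕ (⊖ ev (map θ (constP x *P Qpoly r)))
      ≈⟨ S.+-identityˡ (⊖ ev (map θ (constP x *P Qpoly r))) ⟩
    ⊖ ev (map θ (constP x *P Qpoly r))
      -- The product of the one-term list `constP x` with `Qpoly r` unfolds to the scaled list plus
      -- a trailing `𝟘 ∷ []`.
      ≈⟨ S.-‿cong (ev-map-θ-+ (scaleP x (Qpoly r)) (𝟘 ∷ [])) ⟩
    ⊖ (ev (map θ (scaleP x (Qpoly r))) ⊕ (θ 𝟘 ⊕ (s ⊛ 𝟘)))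
      ≈⟨ S.-‿cong (S.+-cong (ev-map-θ-scale x (constant-Qpoly r))
                            (S.+-cong (θ-const R.0#) (S.zeroʳ s))) ⟩
    ⊖ ((θ x ⊛ ev (Qpoly r)) ⊕ (𝟘 ⊕ 𝟘))
      ≈⟨ solve 1 (λ y → :- (y :+ (:0 :+ :0)) := :- y) S.refl (θ x ⊛ ev (Qpoly r)) ⟩
    ⊖ (θ x ⊛ ev (Qpoly r))
      ≈⟨ S.-‿cong (⊛-cong {θ x} S.refl (ev-Qpoly r)) ⟩
    ⊖ (θ x ⊛ S.powerQuotient r (𝟙 ⊝ s) s) ∎
    where
    A = (tP ^P r) *P (oneMinusT ^P r)
    constant-A : Constant A
    constant-A = constant-* (constant-^ r constant-t) (constant-^ r constant-oneMinusT)

  -- Implicit differentiation of P_r(x; s) = 0.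
  θ-root : ∀ r x → ev (Ppoly r x) ≈PS 𝟘 →
           (θ s ⊛ ev (derivP (Ppoly r x))) ≈PS (θ x ⊛ S.powerQuotient r (𝟙 ⊝ s) s)
  θ-root r x root = begin
    y
      ≈⟨ solve 2 (λ y z → y := z :+ ((:- z) :+ y)) S.refl y z ⟩
    z ⊕ ((⊖ z) ⊕ y)
      ≈⟨ S.+-congˡ {z} (S.+-cong (ev-map-θ-Ppoly r x) S.refl) ⟨
    z ⊕ (ev (map θ (Ppoly r x)) ⊕ y)
      ≈⟨ S.+-congˡ {z} (θ-ev (Ppoly r x)) ⟨
    z ⊕ θ (ev (Ppoly r x))
      ≈⟨ S.+-congˡ {z} (S.trans (θ-cong root) (θ-const R.0#)) ⟩
    z ⊕ 𝟘
      ≈⟨ S.+-identityʳ z ⟩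
    z ∎
    where
    y = θ s ⊛ ev (derivP (Ppoly r x))
    z = θ x ⊛ S.powerQuotient r (𝟙 ⊝ s) s

-- Power sums of a full set of roots of unity.

NoZeroDivisors : ∀ {c ℓ} → CommutativeRing c ℓ → Set (c ⊔ ℓ)
NoZeroDivisors K = ∀ a b → a * b ≈ 0# → (a ≈ 0#) ⊎ (b ≈ 0#)
  where open CommutativeRing K

module RootsOfUnity {c ℓ} (K : CommutativeRing c ℓ)
  (zero-product : NoZeroDivisors K) where
  open CommutativeRing K hiding (zero)
  open PowerSeries K using (natᶜ)
  open IntegerSolver K
  open Powers K
  open import Algebra.Properties.CommutativeMonoid.Sum +-commutativeMonoid
    using (sum; sum-cong-≋; sum-replicate-zero; ∑-distrib-+)
  open import Algebra.Properties.Semiring.Sum semiring using (*-distribˡ-sum)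
  open import Algebra.Properties.Group +-group using (x∙y⁻¹≈ε⇒x≈y)
  open import Relation.Binary.Reasoning.Setoid setoid

  eval : ℕ → (ℕ → Carrier) → Carrier → Carrier
  eval zero a z = 0#
  eval (suc n) a z = a 0 + z * eval n (a ∘ suc) z

  -- Coefficients of the quotient of a(z) - a(c) by z - c, each being the value at c of the part of
  -- a beyond it.
  synthetic : ℕ → (ℕ → Carrier) → Carrier → ℕ → Carrier
  synthetic n a c zero = eval n (a ∘ suc) c
  synthetic zero a c (suc m) = 0#
  synthetic (suc n) a c (suc m) = synthetic n (a ∘ suc) c m

  eval-synthetic : ∀ n a c z →
    eval (suc n) a z - eval (suc n) a c ≈ (z - c) * eval n (synthetic n a c) z
  eval-synthetic zero a c z =
    solve 3 (λ a c z → (a :+ z :* :0) :- (a :+ c :* :0) := (z :- c) :* :0) refl (a 0) c z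
  eval-synthetic (suc n) a c z = begin
    (a 0 + z * x) - (a 0 + c * y)
      ≈⟨ solve 5 (λ a c z x y → (a :+ z :* x) :- (a :+ c :* y)
                              := (z :- c) :* y :+ z :* (x :- y)) refl (a 0) c z x y ⟩
    (z - c) * y + z * (x - y)
      ≈⟨ +-congˡ (*-congˡ (eval-synthetic n (a ∘ suc) c z)) ⟩
    (z - c) * y + z * ((z - c) * q)
      ≈⟨ solve 4 (λ d y z q → d :* y :+ z :* (d :* q) := d :* (y :+ z :* q)) refl (z - c) y z q ⟩
    (z - c) * (y + z * q) ∎
    where
    x = eval (suc n) (a ∘ suc) z
    y = eval (suc n) (a ∘ suc) c
    q = eval n (synthetic n (a ∘ suc) c) z

  -- The zeroth quotient coefficient is the value at c of the shifted polynomial. Its vanishing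
  -- kills `a 0` and is also the root hypothesis for the shifted polynomial.
  synthetic-zero : ∀ n a c → eval (suc n) a c ≈ 0# → (∀ m → m < n → synthetic n a c m ≈ 0#) →
                   ∀ m → m < suc n → a m ≈ 0#
  synthetic-zero zero a c root q≈0 zero _ =
    trans (solve 2 (λ a c → a := a :+ c :* :0) refl (a 0) c) root
  synthetic-zero zero a c root q≈0 (suc m) (s≤s ())
  synthetic-zero (suc n) a c root q≈0 zero _ = begin
    a 0                                     ≈⟨ solve 2 (λ a c → a := a :+ c :* :0) refl (a 0) c ⟩
    a 0 + c * 0#                            ≈⟨ +-congˡ (*-congˡ (q≈0 0 (s≤s z≤n))) ⟨
    a 0 + c * eval (suc n) (a ∘ suc) c      ≈⟨ root ⟩
    0#                                      ∎
  synthetic-zero (suc n) a c root q≈0 (suc m) (s≤s m<) =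
    synthetic-zero n (a ∘ suc) c (q≈0 0 (s≤s z≤n)) (λ k k<n → q≈0 (suc k) (s≤s k<n)) m m<

  -- Dividing out the first root leaves a polynomial with one coefficient less that vanishes at all
  -- the others, because a difference of distinct points is not a zero divisor.
  distinct-roots : ∀ n a (x : Fin n → Carrier) → (∀ i j → x i ≈ x j → i ≡ j) →
                   (∀ i → eval n a (x i) ≈ 0#) → ∀ m → m < n → a m ≈ 0#
  distinct-roots (suc n) a x inj roots = synthetic-zero n a x₀ (roots Fin.zero)
    (distinct-roots n (synthetic n a x₀) (x ∘ Fin.suc)
      (λ i j eq → Fin.suc-injective (inj (Fin.suc i) (Fin.suc j) eq)) deflated)
    where
    x₀ = x Fin.zero
    deflated : ∀ i → eval n (synthetic n a x₀) (x (Fin.suc i)) ≈ 0#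
    deflated i with zero-product (x (Fin.suc i) - x₀) _
      (trans (sym (eval-synthetic n a x₀ (x (Fin.suc i))))
        (trans (+-cong (roots (Fin.suc i)) (-‿cong (roots Fin.zero))) (-‿inverseʳ 0#)))
    ... | inj₁ eq with () ← inj (Fin.suc i) Fin.zero (x∙y⁻¹≈ε⇒x≈y _ _ eq)
    ... | inj₂ eq = eq

  eval-* : ∀ n y a z → eval n (λ m → y * a m) z ≈ y * eval n a z
  eval-* zero y a z = sym (zeroʳ y)
  eval-* (suc n) y a z = trans (+-congˡ (*-congˡ (eval-* n y (a ∘ suc) z)))
    (solve 4 (λ y a z x → y :* a :+ z :* (y :* x) := y :* (a :+ z :* x))
       refl y (a 0) z (eval n (a ∘ suc) z))

  eval-sum : ∀ {k} n (a : Fin k → ℕ → Carrier) z →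
             eval n (λ m → sum (λ i → a i m)) z ≈ sum (λ i → eval n (a i) z)
  eval-sum {k} zero a z = sym (sum-replicate-zero k)
  eval-sum (suc n) a z = begin
    sum (λ i → a i 0) + z * eval n (λ m → sum (λ i → a i (suc m))) z
      ≈⟨ +-congˡ (*-congˡ (eval-sum n (λ i → a i ∘ suc) z)) ⟩
    sum (λ i → a i 0) + z * sum (λ i → eval n (a i ∘ suc) z)
      ≈⟨ +-congˡ (*-distribˡ-sum z (λ i → eval n (a i ∘ suc) z)) ⟩
    sum (λ i → a i 0) + sum (λ i → z * eval n (a i ∘ suc) z)
      ≈⟨ ∑-distrib-+ (λ i → a i 0) (λ i → z * eval n (a i ∘ suc) z) ⟨
    sum (λ i → eval (suc n) (a i) z) ∎

  eval-powers-suc : ∀ n y z → eval (suc n) (y ^_) z ≈ 1# + (z * y) * eval n (y ^_) z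
  eval-powers-suc n y z = +-congˡ (trans (*-congˡ (eval-* n y (y ^_) z)) (sym (*-assoc z y _)))

  eval-powers : ∀ n y z → (1# - z * y) * eval n (y ^_) z ≈ 1# - (z * y) ^ n
  eval-powers zero y z = solve 1 (λ p → (:1 :- p) :* :0 := :1 :- :1) refl (z * y)
  eval-powers (suc n) y z = begin
    (1# - p) * eval (suc n) (y ^_) z
      ≈⟨ *-congˡ (eval-powers-suc n y z) ⟩
    (1# - p) * (1# + p * e)
      ≈⟨ solve 2 (λ p e → (:1 :- p) :* (:1 :+ p :* e) := (:1 :- p) :+ p :* ((:1 :- p) :* e))
           refl p e ⟩
    (1# - p) + p * ((1# - p) * e)
      ≈⟨ +-congˡ (*-congˡ (eval-powers n y z)) ⟩
    (1# - p) + p * (1# - p ^ n)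
      ≈⟨ solve 2 (λ p q → (:1 :- p) :+ p :* (:1 :- q) := :1 :- p :* q) refl p (p ^ n) ⟩
    1# - p ^ suc n ∎
    where
    p = z * y
    e = eval n (y ^_) z

  eval-powers-inverse : ∀ n y z → z * y ≈ 1# → eval n (y ^_) z ≈ natᶜ n
  eval-powers-inverse zero y z zy≈1 = refl
  eval-powers-inverse (suc n) y z zy≈1 = trans (eval-powers-suc n y z)
    (+-congˡ (trans (*-cong zy≈1 (eval-powers-inverse n y z zy≈1)) (*-identityˡ _)))

  sum-only : ∀ {n} (j : Fin n) (f : Fin n → Carrier) → (∀ i → ¬ (i ≡ j) → f i ≈ 0#) → sum f ≈ f j
  sum-only {suc n} Fin.zero f f≈0 = trans
    (+-congˡ (trans (sum-cong-≋ (λ i → f≈0 (Fin.suc i) (λ ()))) (sum-replicate-zero n)))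
    (+-identityʳ _)
  sum-only {suc n} (Fin.suc j) f f≈0 = trans
    (+-cong (f≈0 Fin.zero (λ ()))
            (sum-only j (f ∘ Fin.suc) (λ i i≢j → f≈0 (Fin.suc i) (i≢j ∘ Fin.suc-injective))))
    (+-identityˡ _)

  module _ {n : ℕ} (y : Fin (suc n) → Carrier) (y^≈1 : ∀ i → y i ^ suc n ≈ 1#)
           (y-injective : ∀ i j → y i ≈ y j → i ≡ j) where

    powerSum : ℕ → Carrier
    powerSum m = sum (λ i → y i ^ m)

    private
      -- `z i` is the inverse of `y i`, available without division because y^(n+1) = 1.
      z : Fin (suc n) → Carrier
      z i = y i ^ n

      zy≈1 : ∀ i → z i * y i ≈ 1#
      zy≈1 i = trans (*-comm _ _) (y^≈1 i)

      zy-injective : ∀ i j → z j * y i ≈ 1# → i ≡ j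
      zy-injective i j zy = y-injective i j (begin
        y i                 ≈⟨ *-identityʳ _ ⟨
        y i * 1#            ≈⟨ *-congˡ (zy≈1 j) ⟨
        y i * (z j * y j)   ≈⟨ solve 3 (λ a b c → a :* (b :* c) := b :* a :* c) refl (y i) (z j) (y j) ⟩
        z j * y i * y j     ≈⟨ *-congʳ zy ⟩
        1# * y j            ≈⟨ *-identityˡ _ ⟩
        y j                 ∎)

      -- For p = y_i / y_j the geometric sum satisfies (1 - p)(1 + ... + p^n) = 1 - p^(n+1) = 0, and
      -- p = 1 would force i = j.
      off-diagonal : ∀ j i → ¬ (i ≡ j) → eval (suc n) (y i ^_) (z j) ≈ 0#
      off-diagonal j i i≢j with zero-product (1# - z j * y i) _ (begin
          (1# - p) * eval (suc n) (y i ^_) (z j)    ≈⟨ eval-powers (suc n) (y i) (z j) ⟩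
          1# - p ^ suc n                            ≈⟨ +-congˡ (-‿cong p^≈1) ⟩
          1# - 1#                                   ≈⟨ -‿inverseʳ 1# ⟩
          0#                                        ∎)
        where
        p = z j * y i
        p^≈1 : p ^ suc n ≈ 1#
        p^≈1 = begin
          p ^ suc n                       ≈⟨ ^-distrib-* (z j) (y i) (suc n) ⟩
          z j ^ suc n * y i ^ suc n       ≈⟨ *-cong (^-assocʳ (y j) n (suc n)) (y^≈1 i) ⟩
          y j ^ (n ℕ.* suc n) * 1#        ≡⟨ ≡.cong (λ k → y j ^ k * 1#) (ℕ.*-comm n (suc n)) ⟩
          y j ^ (suc n ℕ.* n) * 1#        ≈⟨ *-congʳ (^-assocʳ (y j) (suc n) n) ⟨
          (y j ^ suc n) ^ n * 1#          ≈⟨ *-congʳ (trans (^-congˡ n (y^≈1 j)) (1^ n)) ⟩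
          1# * 1#                         ≈⟨ *-identityˡ _ ⟩
          1#                              ∎
      ... | inj₁ eq = ⊥-elim (i≢j (zy-injective i j (sym (x∙y⁻¹≈ε⇒x≈y _ _ eq))))
      ... | inj₂ eq = eq

      -- Σ_m powerSum m z^m takes the value n + 1 at each of the n + 1 points 1 / y j.
      shifted : ℕ → Carrier
      shifted zero = powerSum 0 - natᶜ (suc n)
      shifted (suc m) = powerSum (suc m)

      shifted-root : ∀ j → eval (suc n) shifted (z j) ≈ 0#
      shifted-root j = begin
        (powerSum 0 - k) + z j * e
          ≈⟨ solve 3 (λ a k b → (a :- k) :+ b := (a :+ b) :- k) refl (powerSum 0) k (z j * e) ⟩
        eval (suc n) powerSum (z j) - k
          ≈⟨ +-congʳ (eval-sum (suc n) (λ i → y i ^_) (z j)) ⟩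
        sum (λ i → eval (suc n) (y i ^_) (z j)) - k
          ≈⟨ +-congʳ (sum-only j (λ i → eval (suc n) (y i ^_) (z j)) (off-diagonal j)) ⟩
        eval (suc n) (y j ^_) (z j) - k
          ≈⟨ +-congʳ (eval-powers-inverse (suc n) (y j) (z j) (zy≈1 j)) ⟩
        k - k
          ≈⟨ -‿inverseʳ k ⟩
        0# ∎
        where
        k = natᶜ (suc n)
        e = eval n (powerSum ∘ suc) (z j)

    -- The usual multiplication by a primitive root is replaced by root counting: `shifted` has n +
    -- 1 coefficients and vanishes at the n + 1 distinct inverses, so it is identically 0.
    powerSum-below : ∀ m → suc m < suc n → powerSum (suc m) ≈ 0#
    powerSum-below m = distinct-roots (suc n) shifted z
      (λ i j eq → zy-injective i j (trans (*-congʳ (sym eq)) (zy≈1 i))) shifted-root (suc m)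

    powerSum-vanishes : ∀ m → ¬ (m ℕ.% suc n ≡ 0) → powerSum m ≈ 0#
    powerSum-vanishes m m%≢0 with m ℕ.% suc n in eq
    ... | zero = ⊥-elim (m%≢0 ≡.refl)
    ... | suc k = trans (sum-cong-≋ reduce)
        (powerSum-below k (≡.subst (_< suc n) eq (ℕ.m%n<n m (suc n))))
      where
      a = m ℕ./ suc n
      reduce : ∀ i → y i ^ m ≈ y i ^ suc k
      reduce i = begin
        y i ^ m
          ≡⟨ ≡.cong (y i ^_) (ℕ.m≡m%n+[m/n]*n m (suc n)) ⟩
        y i ^ (m ℕ.% suc n ℕ.+ a ℕ.* suc n)
          ≡⟨ ≡.cong₂ (λ b d → y i ^ (b ℕ.+ d)) eq (ℕ.*-comm a (suc n)) ⟩
        y i ^ (suc k ℕ.+ suc n ℕ.* a)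
          ≈⟨ ^-homo-* (y i) (suc k) (suc n ℕ.* a) ⟩
        y i ^ suc k * y i ^ (suc n ℕ.* a)
          ≈⟨ *-congˡ (^-assocʳ (y i) (suc n) a) ⟨
        y i ^ suc k * (y i ^ suc n) ^ a
          ≈⟨ *-congˡ (trans (^-congˡ a (y^≈1 i)) (1^ a)) ⟩
        y i ^ suc k * 1#
          ≈⟨ *-identityʳ _ ⟩
        y i ^ suc k ∎

-- Differences of power quotients and cancellation of units.

module PowerQuotient {c ℓ} (R : CommutativeRing c ℓ) where
  open CommutativeRing R hiding (zero)
  open PowerSeries R using (natᶜ)
  open IntegerSolver R
  open Powers R
  open import Relation.Binary.Reasoning.Setoid setoid

  powerQuotient-1-0 : ∀ n → powerQuotient n 1# 0# ≈ 1#
  powerQuotient-1-0 zero = refl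
  powerQuotient-1-0 (suc n) = trans (+-cong (zeroˡ _) (1^ (suc n))) (+-identityˡ _)

  powerQuotient-diagonal : ∀ n x → powerQuotient n x x ≈ natᶜ (suc n) * x ^ n
  powerQuotient-diagonal zero x = solve 0 (:1 := (:1 :+ :0) :* :1) refl
  powerQuotient-diagonal (suc n) x = trans (+-congʳ (*-congˡ (powerQuotient-diagonal n x)))
    (solve 3 (λ x k p → x :* (k :* p) :+ x :* p := (:1 :+ k) :* (x :* p)) refl x (natᶜ (suc n)) (x ^ n))

  powerQuotient-difference : ∀ n x y → Σ Carrier λ k →
    powerQuotient n (1# - x) x ≈ powerQuotient n (1# - y) y + (x - y) * k
  powerQuotient-difference zero x y = 0# , solve 2 (λ x y → :1 := :1 :+ (x :- y) :* :0) refl x y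
  powerQuotient-difference (suc n) x y with powerQuotient-difference n x y
  -- The recursion has two summands: x (q + (x - y) k) - y q yields the cofactor q + x k, and the
  -- difference of the powers of 1 - x and 1 - y is -(x - y) p.
  ... | k , eq = (q + x * k - p) , (begin
      x * powerQuotient n (1# - x) x + a
        ≈⟨ +-congʳ (*-congˡ eq) ⟩
      x * (q + (x - y) * k) + a
        ≈⟨ solve 6 (λ x y q k a b → x :* (q :+ (x :- y) :* k) :+ a
                 := x :* (q :+ (x :- y) :* k) :+ (b :+ (a :- b))) refl x y q k a b ⟩
      x * (q + (x - y) * k) + (b + (a - b))
        ≈⟨ +-congˡ (+-congˡ (*-powerQuotient n (1# - x) (1# - y))) ⟨
      x * (q + (x - y) * k) + (b + ((1# - x) - (1# - y)) * p)
        ≈⟨ solve 6 (λ x y q k b p →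
                 x :* (q :+ (x :- y) :* k) :+ (b :+ ((:1 :- x) :- (:1 :- y)) :* p)
                 := (y :* q :+ b) :+ (x :- y) :* ((q :+ x :* k) :- p)) refl x y q k b p ⟩
      (y * q + b) + (x - y) * (q + x * k - p) ∎)
    where
    q = powerQuotient n (1# - y) y
    p = powerQuotient n (1# - x) (1# - y)
    a = (1# - x) ^ suc n
    b = (1# - y) ^ suc n

  *-cancel-unit : ∀ {b b′} x y → b * b′ ≈ 1# → x * b ≈ y * b → x ≈ y
  *-cancel-unit {b} {b′} x y bb′≈1 eq = begin
    x             ≈⟨ *-identityʳ x ⟨
    x * 1#        ≈⟨ *-congˡ bb′≈1 ⟨
    x * (b * b′)  ≈⟨ *-assoc _ _ _ ⟨
    x * b * b′    ≈⟨ *-congʳ eq ⟩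
    y * b * b′    ≈⟨ *-assoc _ _ _ ⟩
    y * (b * b′)  ≈⟨ *-congˡ bb′≈1 ⟩
    y * 1#        ≈⟨ *-identityʳ y ⟩
    y             ∎

  ^-inverse : ∀ {b b′} m → b * b′ ≈ 1# → b ^ m * b′ ^ m ≈ 1#
  ^-inverse {b} {b′} m bb′≈1 =
    trans (sym (^-distrib-* b b′ m)) (trans (^-congˡ m bb′≈1) (1^ m))

  -- The difference of the equations V B = Q and V′ B′ = Q′ of two roots s, s′ with s − s′ = x d,
  -- as a multiple of d.
  difference-identity : ∀ {V V′ B B′ Q Q′} d x H L k →
    V - V′ ≈ d * H → B - B′ ≈ - (x * d) * L → Q ≈ Q′ + (x * d) * k →
    V * B ≈ Q → V′ * B′ ≈ Q′ → d * (H * B - x * (V′ * L + k)) ≈ 0#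
  difference-identity {V} {V′} {B} {B′} {Q} {Q′} d x H L k V-V′ B-B′ Q-Q′ VB V′B′ = begin
    d * (H * B - x * (V′ * L + k))
      ≈⟨ solve 6 (λ d H B x W k → d :* (H :* B :- x :* (W :+ k))
                := (d :* H) :* B :- x :* d :* W :- x :* d :* k) refl d H B x (V′ * L) k ⟩
    (d * H) * B - x * d * (V′ * L) - x * d * k
      ≈⟨ +-congʳ (+-congʳ (*-congʳ V-V′)) ⟨
    (V - V′) * B - x * d * (V′ * L) - x * d * k
      ≈⟨ solve 7 (λ V V′ B B′ y L k → (V :- V′) :* B :- y :* (V′ :* L) :- y :* k
                := V :* B :- V′ :* B′ :- V′ :* (B :- B′) :+ V′ :* ((:- y) :* L) :- y :* k)
           refl V V′ B B′ (x * d) L k ⟩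
    V * B - V′ * B′ - V′ * (B - B′) + V′ * (- (x * d) * L) - x * d * k
      ≈⟨ +-congʳ (+-cong (+-cong (+-cong (trans VB Q-Q′) (-‿cong V′B′)) (-‿cong (*-congˡ B-B′))) refl) ⟩
    (Q′ + (x * d) * k) - Q′ - V′ * (- (x * d) * L) + V′ * (- (x * d) * L) - x * d * k
      ≈⟨ solve 3 (λ q y z → (q :+ y) :- q :- z :+ z :- y := :0)
           refl Q′ (x * d * k) (V′ * (- (x * d) * L)) ⟩
    0# ∎

-- Small zeros: uniqueness from the leading coefficient, and coefficients as residues.

module SmallZeros {c ℓ} (K : CommutativeRing c ℓ)
  (natᶜ-regular : TorsionFree K)
  (r′ : ℕ) where
  open CommutativeRing K hiding (zero)
  open PowerSeries K
  open Series K
  open SeriesProperties K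
  open IntegerSolver K
  open Powers K
  open import Algebra.Properties.Group S.+-group using (x∙y⁻¹≈ε⇒x≈y)
  open import Relation.Binary.Reasoning.Setoid setoid
  import Relation.Binary.Reasoning.Setoid S.setoid as SR
  private
    module PQ = PowerQuotient K
    module PQS = PowerQuotient seriesRing

  r : ℕ
  r = suc r′

  Q : PS → PS
  Q s = S.powerQuotient r (𝟙 ⊝ s) s

  OnCurve : PS → Set _
  OnCurve s = (s 0 ≈ 0#) × (((s S.^ r) ⊛ ((𝟙 ⊝ s) S.^ r)) ≈PS ((X S.^ r) ⊛ Q s))

  oneMinus-head : ∀ s → s 0 ≈ 0# → (𝟙 ⊝ s) 0 ≈ 1#
  oneMinus-head s s0≈0 = trans (+-congˡ (-‿cong s0≈0)) (solve 0 (:1 :- :0 := :1) refl)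

  oneMinus^-head : ∀ s → s 0 ≈ 0# → ∀ m → ((𝟙 ⊝ s) S.^ m) 0 ≈ 1#
  oneMinus^-head s s0≈0 m = trans (^-head (𝟙 ⊝ s) m) (trans (^-congˡ m (oneMinus-head s s0≈0)) (1^ m))

  Q-head : ∀ s → s 0 ≈ 0# → Q s 0 ≈ 1#
  Q-head s s0≈0 = begin
    Q s 0                                  ≈⟨ powerQuotient-head r (𝟙 ⊝ s) s ⟩
    powerQuotient r ((𝟙 ⊝ s) 0) (s 0)      ≈⟨ powerQuotient-cong r (oneMinus-head s s0≈0) s0≈0 ⟩
    powerQuotient r 1# 0#                  ≈⟨ PQ.powerQuotient-1-0 r ⟩
    1#                                     ∎

  -- Dividing by X^r desingularises the equation: at X = 0 it becomes v(0)^r = 1, whose roots are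
  -- simple.
  tail-equation : ∀ s → OnCurve s → ((tail s S.^ r) ⊛ ((𝟙 ⊝ s) S.^ r)) ≈PS Q s
  tail-equation s (s0≈0 , curve) = X^-cancel r ((tail s S.^ r) ⊛ B) (Q s) (SR.begin
    (X S.^ r) ⊛ ((tail s S.^ r) ⊛ B)
      SR.≈⟨ S.*-assoc (X S.^ r) (tail s S.^ r) B ⟨
    ((X S.^ r) ⊛ (tail s S.^ r)) ⊛ B
      SR.≈⟨ ⊛-cong {g = B} (S.^-distrib-* X (tail s) r) S.refl ⟨
    ((X ⊛ tail s) S.^ r) ⊛ B
      SR.≈⟨ ⊛-cong {g = B} (S.^-congˡ r (X⊛-tail s s0≈0)) S.refl ⟨
    (s S.^ r) ⊛ B
      SR.≈⟨ curve ⟩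
    (X S.^ r) ⊛ Q s SR.∎)
    where B = (𝟙 ⊝ s) S.^ r

  leading^r≈1 : ∀ s → OnCurve s → s 1 ^ r ≈ 1#
  leading^r≈1 s on@(s0≈0 , _) = begin
    s 1 ^ r                         ≈⟨ *-identityʳ _ ⟨
    s 1 ^ r * 1#                    ≈⟨ *-cong (^-head (tail s) r) (oneMinus^-head s s0≈0 r) ⟨
    (tail s S.^ r) 0 * B 0          ≈⟨ ⊛-zero (tail s S.^ r) B ⟨
    ((tail s S.^ r) ⊛ B) 0          ≈⟨ tail-equation s on 0 ⟩
    Q s 0                           ≈⟨ Q-head s s0≈0 ⟩
    1#                              ∎
    where B = (𝟙 ⊝ s) S.^ r

  -- Uniqueness in Hensel's lemma. Subtracting the two tail equations gives d m = 0 for the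
  -- difference d of the tails; equal leading coefficients make m(0) = r s_1^(r-1), the derivative
  -- of v^r at s_1, which is regular.
  leading-determines : ∀ s s′ → OnCurve s → OnCurve s′ → s 1 ≈ s′ 1 → s ≈PS s′
  leading-determines s s′ on@(s0≈0 , _) on′@(s′0≈0 , _) s1≈s′1 = SR.begin
    s             SR.≈⟨ X⊛-tail s s0≈0 ⟩
    X ⊛ tail s    SR.≈⟨ ⊛-cong {X} S.refl (x∙y⁻¹≈ε⇒x≈y (tail s) (tail s′) d≈0) ⟩
    X ⊛ tail s′   SR.≈⟨ X⊛-tail s′ s′0≈0 ⟨
    s′            SR.∎
    where
    v = tail s
    v′ = tail s′
    d = v ⊝ v′
    e = X ⊛ d
    B = (𝟙 ⊝ s) S.^ r
    B′ = (𝟙 ⊝ s′) S.^ r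
    H = S.powerQuotient r′ v v′
    L = S.powerQuotient r′ (𝟙 ⊝ s) (𝟙 ⊝ s′)
    k = proj₁ (PQS.powerQuotient-difference r s s′)

    e≈ : (s ⊝ s′) ≈PS e
    e≈ = SR.begin
      s ⊝ s′                  SR.≈⟨ S.+-cong (X⊛-tail s s0≈0) (S.-‿cong (X⊛-tail s′ s′0≈0)) ⟩
      (X ⊛ v) ⊝ (X ⊛ v′)      SR.≈⟨ S.solve 3 (λ x v w → x S.:* v S.:- x S.:* w S.:= x S.:* (v S.:- w))
                                     S.refl X v v′ ⟩
      X ⊛ d                   SR.∎

    B-B′ : (B ⊝ B′) ≈PS ((⊖ e) ⊛ L)
    B-B′ = SR.begin
      B ⊝ B′
        SR.≈⟨ S.*-powerQuotient r′ (𝟙 ⊝ s) (𝟙 ⊝ s′) ⟨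
      ((𝟙 ⊝ s) ⊝ (𝟙 ⊝ s′)) ⊛ L
        SR.≈⟨ ⊛-cong {g = L} (S.solve 2 (λ x y → (S.:1 S.:- x) S.:- (S.:1 S.:- y) S.:= S.:- (x S.:- y))
                S.refl s s′) S.refl ⟩
      (⊖ (s ⊝ s′)) ⊛ L
        SR.≈⟨ ⊛-cong {g = L} (S.-‿cong e≈) S.refl ⟩
      (⊖ e) ⊛ L SR.∎

    Q-Q′ : Q s ≈PS (Q s′ ⊕ (e ⊛ k))
    Q-Q′ = S.trans (proj₂ (PQS.powerQuotient-difference r s s′))
      (S.+-congˡ {Q s′} (⊛-cong {g = k} e≈ S.refl))

    m = (H ⊛ B) ⊝ (X ⊛ (((v′ S.^ r) ⊛ L) ⊕ k))

    dm≈0 : (d ⊛ m) ≈PS 𝟘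
    dm≈0 = PQS.difference-identity d X H L k (S.sym (S.*-powerQuotient r′ v v′)) B-B′ Q-Q′
             (tail-equation s on) (tail-equation s′ on′)

    m-head : m 0 ≈ natᶜ r * s 1 ^ r′
    m-head = begin
      (H ⊛ B) 0 - (X ⊛ (((v′ S.^ r) ⊛ L) ⊕ k)) 0
        ≈⟨ +-cong (⊛-zero H B) (-‿cong (X⊛-zero (((v′ S.^ r) ⊛ L) ⊕ k))) ⟩
      H 0 * B 0 - 0#
        ≈⟨ +-congʳ (*-cong (powerQuotient-head r′ v v′) (oneMinus^-head s s0≈0 r)) ⟩
      powerQuotient r′ (s 1) (s′ 1) * 1# - 0#
        ≈⟨ solve 1 (λ x → x :* :1 :- :0 := x) refl _ ⟩
      powerQuotient r′ (s 1) (s′ 1)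
        ≈⟨ powerQuotient-cong r′ refl (sym s1≈s′1) ⟩
      powerQuotient r′ (s 1) (s 1)
        ≈⟨ PQ.powerQuotient-diagonal r′ (s 1) ⟩
      natᶜ r * s 1 ^ r′ ∎

    d≈0 : d ≈PS 𝟘
    -- Multiplying m(0) by the leading coefficient completes its power to s_1^r = 1, so only the
    -- integer r has to be cancelled.
    d≈0 = ⊛-cancel-0 d m (λ x xm≈0 → natᶜ-regular r′ x (begin
      natᶜ r * x
        ≈⟨ *-identityʳ _ ⟨
      natᶜ r * x * 1#
        ≈⟨ *-congˡ (leading^r≈1 s on) ⟨
      natᶜ r * x * (s 1 * s 1 ^ r′)
        ≈⟨ solve 4 (λ n x a b → n :* x :* (a :* b) := x :* (n :* b) :* a)
             refl (natᶜ r) x (s 1) (s 1 ^ r′) ⟩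
      x * (natᶜ r * s 1 ^ r′) * s 1
        ≈⟨ *-congʳ (*-congˡ m-head) ⟨
      x * m 0 * s 1
        ≈⟨ trans (*-congʳ xm≈0) (zeroˡ _) ⟩
      0# ∎)) dm≈0

  D² : PS → PS
  D² s = (𝟙 ⊝ (two · s)) S.^ 2

  module _ (s : PS) (on : OnCurve s) where
    private
      s0≈0 = proj₁ on
      v = tail s
      B = (𝟙 ⊝ s) S.^ r
      Q⁻¹ = proj₁ (SeriesInverse.inverse K (Q s) (Q-head s s0≈0))
      [1-s]⁻¹ = proj₁ (SeriesInverse.inverse K (𝟙 ⊝ s) (oneMinus-head s s0≈0))

      -- The inverse of v, obtained from v^r B = Q with Q(0) = 1. The series `inverse` needs
      -- constant term 1, which v itself, starting with a root of unity, need not have.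
      u : PS
      u = (v S.^ r′) ⊛ (B ⊛ Q⁻¹)

      uv≈1 : (u ⊛ v) ≈PS 𝟙
      uv≈1 = SR.begin
        ((v S.^ r′) ⊛ (B ⊛ Q⁻¹)) ⊛ v
          SR.≈⟨ S.solve 4 (λ p b q v → p S.:* (b S.:* q) S.:* v S.:= v S.:* p S.:* b S.:* q)
                  S.refl (v S.^ r′) B Q⁻¹ v ⟩
        ((v S.^ r) ⊛ B) ⊛ Q⁻¹
          SR.≈⟨ ⊛-cong {g = Q⁻¹} (tail-equation s on) S.refl ⟩
        Q s ⊛ Q⁻¹
          SR.≈⟨ proj₂ (SeriesInverse.inverse K (Q s) (Q-head s s0≈0)) ⟩
        𝟙 SR.∎

    open Composition K s s0≈0
    private module Res = Residue K natᶜ-regular s u s0≈0 uv≈1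
    open Res using (w; residue)

    θ-tail : θ s ≈PS (X ⊛ w)
    θ-tail = SR.begin
      θ s                           SR.≈⟨ θ-cong (X⊛-tail s s0≈0) ⟩
      θ (X ⊛ v)                     SR.≈⟨ θ-⊛ X v ⟩
      (θ X ⊛ v) ⊕ (X ⊛ θ v)         SR.≈⟨ S.+-cong (⊛-cong {g = v} θ-X S.refl) S.refl ⟩
      (X ⊛ v) ⊕ (X ⊛ θ v)           SR.≈⟨ S.distribˡ X v (θ v) ⟨
      X ⊛ w                         SR.∎

    module _ (G : PS) (k : ℕ)
      (G≈ : (G ⊛ (lin 1# S.^ (r ℕ.* suc k)))
            ≈PS ((S.powerQuotient r (lin 1#) X S.^ suc k) ⊛ (lin two S.^ 2))) where
      private
        N = r ℕ.* suc k
        -- `suc M` computes to N, so M is N - 1 without truncated subtraction and `N ∸ 1` unfolds to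
        -- it.
        M = k ℕ.+ r′ ℕ.* suc k

        compose-lin-1 : compose (lin 1#) ≈PS (𝟙 ⊝ s)
        compose-lin-1 = S.trans (compose-lin 1#) (S.+-congˡ {𝟙} (S.-‿cong (S.*-identityˡ s)))

        compose-lin-two : compose (lin two) ≈PS (𝟙 ⊝ (two · s))
        compose-lin-two = S.trans (compose-lin two) (S.+-congˡ {𝟙} (S.-‿cong (const-⊛ two s)))

        Q^ : (Q s S.^ suc k) ≈PS ((v S.^ N) ⊛ ((𝟙 ⊝ s) S.^ N))
        Q^ = SR.begin
          Q s S.^ suc k
            SR.≈⟨ S.^-congˡ (suc k) (tail-equation s on) ⟨
          ((v S.^ r) ⊛ B) S.^ suc k
            SR.≈⟨ S.^-distrib-* (v S.^ r) B (suc k) ⟩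
          ((v S.^ r) S.^ suc k) ⊛ (B S.^ suc k)
            SR.≈⟨ ⊛-cong (S.^-assocʳ v r (suc k)) (S.^-assocʳ (𝟙 ⊝ s) r (suc k)) ⟩
          (v S.^ N) ⊛ ((𝟙 ⊝ s) S.^ N) SR.∎

      -- Composing the equation for G with s turns its power quotient into Q(s), and by the tail
      -- equation Q(s)^(k+1) = v^N (1 - s)^N; the unit (1 - s)^N cancels.
      compose-integrand : compose G ≈PS (D² s ⊛ (v S.^ N))
      compose-integrand = PQS.*-cancel-unit {(𝟙 ⊝ s) S.^ N} {[1-s]⁻¹ S.^ N} (compose G) (D² s ⊛ (v S.^ N))
        (PQS.^-inverse {𝟙 ⊝ s} {[1-s]⁻¹} N (proj₂ (SeriesInverse.inverse K (𝟙 ⊝ s) (oneMinus-head s s0≈0)))) (SR.begin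
        compose G ⊛ ((𝟙 ⊝ s) S.^ N)
          SR.≈⟨ ⊛-cong {compose G} S.refl (S.trans (^-compose (lin 1#) N) (S.^-congˡ N compose-lin-1)) ⟨
        compose G ⊛ compose (lin 1# S.^ N)
          SR.≈⟨ compose-⊛ G (lin 1# S.^ N) ⟨
        compose (G ⊛ (lin 1# S.^ N))
          SR.≈⟨ compose-cong G≈ ⟩
        compose ((q S.^ suc k) ⊛ (lin two S.^ 2))
          SR.≈⟨ compose-⊛ (q S.^ suc k) (lin two S.^ 2) ⟩
        compose (q S.^ suc k) ⊛ compose (lin two S.^ 2)
          SR.≈⟨ ⊛-cong (^-compose q (suc k)) (^-compose (lin two) 2) ⟩
        (compose q S.^ suc k) ⊛ (compose (lin two) S.^ 2)
          SR.≈⟨ ⊛-cong (S.^-congˡ (suc k) (S.trans (powerQuotient-compose r (lin 1#) X)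
                          (S.powerQuotient-cong r compose-lin-1 compose-X)))
                       (S.^-congˡ 2 compose-lin-two) ⟩
        (Q s S.^ suc k) ⊛ D² s
          SR.≈⟨ ⊛-cong {g = D² s} Q^ S.refl ⟩
        ((v S.^ N) ⊛ ((𝟙 ⊝ s) S.^ N)) ⊛ D² s
          SR.≈⟨ S.solve 3 (λ a b d → a S.:* b S.:* d S.:= d S.:* a S.:* b)
                  S.refl (v S.^ N) ((𝟙 ⊝ s) S.^ N) (D² s) ⟩
        (D² s ⊛ (v S.^ N)) ⊛ ((𝟙 ⊝ s) S.^ N) SR.∎)
        where q = S.powerQuotient r (lin 1#) X

      -- Here θ s = X w uses up one degree, and `compose-integrand` exhibits (1 - 2s)^2 as G(s) u^N,
      -- the shape required by `residue`.
      coefficient : (θ s ⊛ D² s) N ≈ G M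
      coefficient = begin
        (θ s ⊛ D² s) (suc M)
          ≈⟨ ⊛-cong {g = D² s} θ-tail S.refl (suc M) ⟩
        ((X ⊛ w) ⊛ D² s) (suc M)
          ≈⟨ S.*-assoc X w (D² s) (suc M) ⟩
        (X ⊛ (w ⊛ D² s)) (suc M)
          ≈⟨ X⊛-suc (w ⊛ D² s) M ⟩
        (w ⊛ D² s) M
          ≈⟨ ⊛-cong {w} S.refl D²≈ M ⟩
        (w ⊛ (compose G ⊛ (u S.^ N))) M
          ≈⟨ S.solve 3 (λ w g u → w S.:* (g S.:* u) S.:= g S.:* (u S.:* w))
               S.refl w (compose G) (u S.^ N) M ⟩
        (compose G ⊛ ((u S.^ N) ⊛ w)) M
          ≈⟨ residue M G ⟩
        G M ∎
        where
        D²≈ : D² s ≈PS (compose G ⊛ (u S.^ N))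
        D²≈ = SR.begin
          D² s
            SR.≈⟨ S.*-identityʳ (D² s) ⟨
          D² s ⊛ 𝟙
            SR.≈⟨ ⊛-cong {D² s} S.refl (PQS.^-inverse {u} {v} N uv≈1) ⟨
          D² s ⊛ ((u S.^ N) ⊛ (v S.^ N))
            SR.≈⟨ S.solve 3 (λ d u v → d S.:* (u S.:* v) S.:= d S.:* v S.:* u)
                    S.refl (D² s) (u S.^ N) (v S.^ N) ⟩
          (D² s ⊛ (v S.^ N)) ⊛ (u S.^ N)
            SR.≈⟨ ⊛-cong {g = u S.^ N} compose-integrand S.refl ⟨
          compose G ⊛ (u S.^ N) SR.∎

-- Inverses of positive integers in ℚ.

natᶜ-nonNegative : ∀ n → ℚ.NonNegative (Qser.natᶜ n)
natᶜ-positive : ∀ n → ℚ.Positive (Qser.natᶜ (suc n))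
natᶜ-nonNegative zero = _
natᶜ-nonNegative (suc n) = ℚ.pos⇒nonNeg (Qser.natᶜ (suc n)) {{natᶜ-positive n}}
natᶜ-positive n = ℚ.pos+nonNeg⇒pos 1ℚ (Qser.natᶜ n) {{natᶜ-nonNegative n}}

1/natᶜ : ℕ → ℚ
1/natᶜ n = ℚ.1/_ (Qser.natᶜ (suc n)) {{ℚ.pos⇒nonZero (Qser.natᶜ (suc n)) {{natᶜ-positive n}}}}

natᶜ-*-1/natᶜ : ∀ n → Qser.natᶜ (suc n) ℚ.* 1/natᶜ n ≡ 1ℚ
natᶜ-*-1/natᶜ n =
  ℚ.*-inverseʳ (Qser.natᶜ (suc n)) {{ℚ.pos⇒nonZero (Qser.natᶜ (suc n)) {{natᶜ-positive n}}}}

-- Summation over the small zeros and comparison of coefficients.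

module ResidueSum {c ℓ} (K : CommutativeRing c ℓ)
  (φ : ℚ → CommutativeRing.Carrier K)
  (hom : IsRingHomomorphism (CommutativeRing.rawRing ℚring) (CommutativeRing.rawRing K) φ)
  (zero-product : NoZeroDivisors K)
  (r′ : ℕ)
  (t : Fin (suc r′) → PowerSeries.PS K)
  (zeros : ∀ i → PowerSeries.IsSmallZero K (suc r′) (t i))
  (distinct : ∀ i j → PowerSeries._≈PS_ K (t i) (t j) → i ≡ j) where
  open CommutativeRing K hiding (zero)
  open PowerSeries K
  open Sums K
  open Series K
  open SeriesProperties K
  open IntegerSolver K
  open Powers K
  open IsRingHomomorphism hom
  open RootsOfUnity K zero-product using (powerSum; powerSum-vanishes)
  open import Algebra.Properties.CommutativeMonoid.Sum +-commutativeMonoid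
    using (sum; sum-cong-≋)
  open import Algebra.Properties.Semiring.Sum semiring using (*-distribˡ-sum)
  open import Algebra.Properties.Group S.+-group using (x∙y⁻¹≈ε⇒x≈y)
  open import Relation.Binary.Reasoning.Setoid setoid
  import Relation.Binary.Reasoning.Setoid S.setoid as SR
  private
    module Map = MapSeries ℚring K φ hom
    module Qs = Series ℚring
    module QI = Integrand ℚring
    module QP = SeriesProperties ℚring

  natᶜ-φ1/natᶜ : ∀ n → natᶜ (suc n) * φ (1/natᶜ n) ≈ 1#
  natᶜ-φ1/natᶜ n = begin
    natᶜ (suc n) * φ (1/natᶜ n)                 ≈⟨ *-congʳ (Map.natᶜ-homo (suc n)) ⟨
    φ (Qser.natᶜ (suc n)) * φ (1/natᶜ n)        ≈⟨ *-homo (Qser.natᶜ (suc n)) (1/natᶜ n) ⟨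
    φ (Qser.natᶜ (suc n) ℚ.* 1/natᶜ n)          ≡⟨ ≡.cong φ (natᶜ-*-1/natᶜ n) ⟩
    φ 1ℚ                                        ≈⟨ 1#-homo ⟩
    1#                                          ∎

  -- Positive integers are units of K, their inverses being the images under φ of rational ones.
  natᶜ-regular : ∀ n x → natᶜ (suc n) * x ≈ 0# → x ≈ 0#
  natᶜ-regular n x nx≈0 = begin
    x                                       ≈⟨ *-identityˡ x ⟨
    1# * x                                  ≈⟨ *-congʳ (natᶜ-φ1/natᶜ n) ⟨
    natᶜ (suc n) * φ (1/natᶜ n) * x         ≈⟨ solve 3 (λ a b x → a :* b :* x := b :* (a :* x)) refl _ _ x ⟩
    φ (1/natᶜ n) * (natᶜ (suc n) * x)       ≈⟨ trans (*-congˡ nx≈0) (zeroʳ _) ⟩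
    0#                                      ∎

  open SmallZeros K natᶜ-regular r′

  onCurve : ∀ i → OnCurve (t i)
  onCurve i = proj₁ (zeros i) , S.trans
    (x∙y⁻¹≈ε⇒x≈y ((s S.^ r) ⊛ ((𝟙 ⊝ s) S.^ r)) (xSer r ⊛ Q s)
      (S.trans (S.sym (Evaluation.ev-Ppoly K s r (xSer r))) (proj₂ (zeros i))))
    (⊛-cong {g = Q s} (^^≈^ X r) S.refl)
    where s = t i

  leading : Fin r → Carrier
  leading i = t i 1

  leading^r : ∀ i → leading i ^ r ≈ 1#
  leading^r i = leading^r≈1 (t i) (onCurve i)

  leading-injective : ∀ i j → leading i ≈ leading j → i ≡ j
  leading-injective i j eq =
    distinct i j (leading-determines (t i) (t j) (onCurve i) (onCurve j) eq)

  ρ : Carrier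
  ρ = φ (1/natᶜ r′)

  -- ρ = 1/r, and θ t · P′(t) = r X^r Q(t) turns numer / P′(t) into (1/r) θ t (1 − 2t)².
  q : Fin r → PS
  q i = const ρ ⊛ (θ (t i) ⊛ D² (t i))

  θ-xSer : θ (xSer r) ≈PS (const (natᶜ r) ⊛ (X S.^ r))
  θ-xSer n = begin
    natᶜ n * (X ^^ r) n               ≈⟨ *-congˡ (^^≈^ X r n) ⟩
    natᶜ n * (X S.^ r) n              ≈⟨ degree n ⟩
    natᶜ r * (X S.^ r) n              ≈⟨ const-⊛ (natᶜ r) (X S.^ r) n ⟨
    (const (natᶜ r) ⊛ (X S.^ r)) n    ∎
    where
    degree : ∀ n → natᶜ n * (X S.^ r) n ≈ natᶜ r * (X S.^ r) n
    degree n with n ℕ.≟ r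
    ... | yes ≡.refl = refl
    ... | no n≢r = trans (trans (*-congˡ (X^-other r n n≢r)) (zeroʳ _))
                         (sym (trans (*-congˡ (X^-other r n n≢r)) (zeroʳ _)))

  -- The factor r coming from θ(X^r) = r X^r cancels against ρ, and the curve equation turns X^r
  -- Q(s) back into s^r (1 - s)^r.
  q-quotient : ∀ i → (q i ⊛ evalP (derivP (Ppoly r (xSer r))) (t i)) ≈PS numer r (t i)
  q-quotient i = SR.begin
    (const ρ ⊛ (θ s ⊛ D² s)) ⊛ P′
      SR.≈⟨ S.solve 4 (λ a t d p → a S.:* (t S.:* d) S.:* p S.:= a S.:* (t S.:* p) S.:* d)
              S.refl (const ρ) (θ s) (D² s) P′ ⟩
    (const ρ ⊛ (θ s ⊛ P′)) ⊛ D² s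
      SR.≈⟨ ⊛-cong {g = D² s} (⊛-cong {const ρ} S.refl
              (Evaluation.θ-root K s r (xSer r) (proj₂ (zeros i)))) S.refl ⟩
    (const ρ ⊛ (θ (xSer r) ⊛ Q s)) ⊛ D² s
      SR.≈⟨ ⊛-cong {g = D² s} (⊛-cong {const ρ} S.refl (⊛-cong {g = Q s} θ-xSer S.refl)) S.refl ⟩
    (const ρ ⊛ ((const (natᶜ r) ⊛ (X S.^ r)) ⊛ Q s)) ⊛ D² s
      SR.≈⟨ S.solve 5 (λ a n x q d → a S.:* (n S.:* x S.:* q) S.:* d S.:= (n S.:* a) S.:* ((x S.:* q) S.:* d))
              S.refl (const ρ) (const (natᶜ r)) (X S.^ r) (Q s) (D² s) ⟩
    (const (natᶜ r) ⊛ const ρ) ⊛ (((X S.^ r) ⊛ Q s) ⊛ D² s)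
      SR.≈⟨ ⊛-cong {g = ((X S.^ r) ⊛ Q s) ⊛ D² s}
              (S.trans (S.sym (const-* (natᶜ r) ρ)) (const-cong (natᶜ-φ1/natᶜ r′))) S.refl ⟩
    𝟙 ⊛ (((X S.^ r) ⊛ Q s) ⊛ D² s)
      SR.≈⟨ S.*-identityˡ (((X S.^ r) ⊛ Q s) ⊛ D² s) ⟩
    ((X S.^ r) ⊛ Q s) ⊛ D² s
      SR.≈⟨ ⊛-cong {g = D² s} (proj₂ (onCurve i)) S.refl ⟨
    ((s S.^ r) ⊛ ((𝟙 ⊝ s) S.^ r)) ⊛ D² s
      SR.≈⟨ ⊛-cong (⊛-cong (^^≈^ s r) (^^≈^ (𝟙 ⊝ s) r)) (^^≈^ (𝟙 ⊝ (two · s)) 2) ⟨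
    numer r s SR.∎
    where
    s = t i
    P′ = evalP (derivP (Ppoly r (xSer r))) s

  sumFin-coefficient : ∀ {m} (f : Fin m → PS) n → sumFin f n ≈ sum (λ i → f i n)
  sumFin-coefficient {zero} f n = 𝟘≈0 n
  sumFin-coefficient {suc m} f n = +-congˡ (sumFin-coefficient (f ∘ Fin.suc) n)

  G : ℕ → PS
  G k = φ ∘ trIntegrand (suc k) r

  -- Carries `integrand≈` from ℚ to K coefficientwise; this equation is all that `coefficient` asks
  -- of G.
  G≈ : ∀ k → (G k ⊛ (lin 1# S.^ (r ℕ.* suc k)))
             ≈PS ((S.powerQuotient r (lin 1#) X S.^ suc k) ⊛ (lin two S.^ 2))
  G≈ k = SR.begin
    G k ⊛ (lin 1# S.^ N)
      SR.≈⟨ ⊛-cong {G k} S.refl (S.trans (H.^-homo (Qser.lin 1ℚ) N) (S.^-congˡ N lin-1)) ⟨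
    G k ⊛ (φ ∘ (Qser.lin 1ℚ QP.S.^ N))
      SR.≈⟨ Map.map-⊛ (trIntegrand (suc k) r) (Qser.lin 1ℚ QP.S.^ N) ⟨
    φ ∘ (trIntegrand (suc k) r Qser.⊛ (Qser.lin 1ℚ QP.S.^ N))
      SR.≈⟨ (λ n → ⟦⟧-cong (QI.integrand≈ k r n)) ⟩
    φ ∘ ((p QP.S.^ suc k) Qser.⊛ (Qser.lin Qser.two QP.S.^ 2))
      SR.≈⟨ Map.map-⊛ (p QP.S.^ suc k) (Qser.lin Qser.two QP.S.^ 2) ⟩
    (φ ∘ (p QP.S.^ suc k)) ⊛ (φ ∘ (Qser.lin Qser.two QP.S.^ 2))
      SR.≈⟨ ⊛-cong
              (S.trans (H.^-homo p (suc k)) (S.^-congˡ (suc k)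
                (S.trans (H.powerQuotient-homo r (Qser.lin 1ℚ) Qser.X)
                         (S.powerQuotient-cong r lin-1 Map.map-X))))
              (S.trans (H.^-homo (Qser.lin Qser.two) 2) (S.^-congˡ 2 lin-2)) ⟩
    (S.powerQuotient r (lin 1#) X S.^ suc k) ⊛ (lin two S.^ 2) SR.∎
    where
    module H = HomomorphismPowers Qs.seriesRing seriesRing (φ ∘_) Map.map-isRingHomomorphism
    N = r ℕ.* suc k
    p = QP.S.powerQuotient r (Qser.lin 1ℚ) Qser.X
    lin-cong : ∀ {a b} → a ≈ b → lin a ≈PS lin b
    lin-cong a≈b zero = refl
    lin-cong a≈b (suc zero) = -‿cong a≈b
    lin-cong a≈b (suc (suc n)) = refl
    lin-1 : (φ ∘ Qser.lin 1ℚ) ≈PS lin 1#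
    lin-1 = S.trans (Map.map-lin 1ℚ) (lin-cong 1#-homo)
    lin-2 : (φ ∘ Qser.lin Qser.two) ≈PS lin two
    lin-2 = S.trans (Map.map-lin Qser.two)
      (lin-cong (trans (+-homo 1ℚ 1ℚ) (+-cong 1#-homo 1#-homo)))

  sum-const : ∀ m x → sum {m} (λ _ → x) ≈ natᶜ m * x
  sum-const zero x = sym (zeroˡ x)
  sum-const (suc m) x = trans (+-congˡ (sum-const m x))
    (solve 2 (λ n x → x :+ n :* x := (:1 :+ n) :* x) refl (natᶜ m) x)

  -- The residue does not depend on the chosen zero, so r equal terms appear, each carrying ρ = 1/r.
  sum-q-multiple : ∀ k → sumFin q (r ℕ.* suc k) ≈ G k (r ℕ.* suc k ∸ 1)
  sum-q-multiple k = begin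
    sumFin q N
      ≈⟨ sumFin-coefficient q N ⟩
    sum (λ i → q i N)
      ≈⟨ sum-cong-≋ (λ i → trans (const-⊛ ρ (θ (t i) ⊛ D² (t i)) N)
           (*-congˡ (coefficient (t i) (onCurve i) (G k) k (G≈ k)))) ⟩
    sum {r} (λ i → ρ * g)
      ≈⟨ sum-const r (ρ * g) ⟩
    natᶜ r * (ρ * g)
      ≈⟨ *-assoc _ _ _ ⟨
    natᶜ r * ρ * g
      ≈⟨ trans (*-congʳ (natᶜ-φ1/natᶜ r′)) (*-identityˡ g) ⟩
    g ∎
    where
    N = r ℕ.* suc k
    g = G k (N ∸ 1)

  -- t j (X) = t 0 (d X) for the r-th root of unity d = leading j / leading 0.
  ratio : Fin r → Carrier
  ratio j = leading Fin.zero ^ r′ * leading j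

  ratio^r : ∀ j → ratio j ^ r ≈ 1#
  ratio^r j = begin
    (a ^ r′ * leading j) ^ r            ≈⟨ ^-distrib-* (a ^ r′) (leading j) r ⟩
    (a ^ r′) ^ r * leading j ^ r        ≈⟨ *-cong (^-assocʳ a r′ r) (leading^r j) ⟩
    a ^ (r′ ℕ.* r) * 1#                 ≡⟨ ≡.cong (λ k → a ^ k * 1#) (ℕ.*-comm r′ r) ⟩
    a ^ (r ℕ.* r′) * 1#                 ≈⟨ *-congʳ (^-assocʳ a r r′) ⟨
    (a ^ r) ^ r′ * 1#                   ≈⟨ *-congʳ (trans (^-congˡ r′ (leading^r Fin.zero)) (1^ r′)) ⟩
    1# * 1#                             ≈⟨ *-identityˡ _ ⟩
    1#                                  ∎
    where a = leading Fin.zero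

  module _ (j : Fin r) where
    open Scaling K (ratio j)
    private
      s = t Fin.zero
      module H = HomomorphismPowers seriesRing seriesRing scale scale-isRingHomomorphism

      scale-oneMinus : scale (𝟙 ⊝ s) ≈PS (𝟙 ⊝ scale s)
      scale-oneMinus = S.trans (H.minus-homo 𝟙 s) (S.+-cong scale-1 S.refl)

    -- The curve equation involves X only through X^r, which X ↦ d X fixes when d^r = 1.
    scale-onCurve : OnCurve (scale s)
    scale-onCurve = trans (*-identityˡ _) (proj₁ (zeros Fin.zero)) , (SR.begin
      (scale s S.^ r) ⊛ ((𝟙 ⊝ scale s) S.^ r)
        SR.≈⟨ ⊛-cong (H.^-homo s r)
                (S.trans (H.^-homo (𝟙 ⊝ s) r) (S.^-congˡ r scale-oneMinus)) ⟨
      scale (s S.^ r) ⊛ scale ((𝟙 ⊝ s) S.^ r)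
        SR.≈⟨ scale-⊛ (s S.^ r) ((𝟙 ⊝ s) S.^ r) ⟨
      scale ((s S.^ r) ⊛ ((𝟙 ⊝ s) S.^ r))
        SR.≈⟨ scale-cong (proj₂ (onCurve Fin.zero)) ⟩
      scale ((X S.^ r) ⊛ Q s)
        SR.≈⟨ scale-⊛ (X S.^ r) (Q s) ⟩
      scale (X S.^ r) ⊛ scale (Q s)
        SR.≈⟨ ⊛-cong (scale-X^ r (ratio^r j)) (S.trans (H.powerQuotient-homo r (𝟙 ⊝ s) s)
                (S.powerQuotient-cong r scale-oneMinus S.refl)) ⟩
      (X S.^ r) ⊛ Q (scale s) SR.∎)

    -- Both sides are small zeros starting with `leading j`: in `ratio j` the power with exponent r′
    -- is the inverse of the leading coefficient of t_0.
    t≈scale : t j ≈PS scale s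
    t≈scale = leading-determines (t j) (scale s) (onCurve j) scale-onCurve (begin
      leading j
        ≈⟨ *-identityˡ _ ⟨
      1# * leading j
        ≈⟨ *-congʳ (leading^r Fin.zero) ⟨
      leading Fin.zero * leading Fin.zero ^ r′ * leading j
        ≈⟨ solve 3 (λ a b c → a :* b :* c := (b :* c) :* :1 :* a)
             refl (leading Fin.zero) (leading Fin.zero ^ r′) (leading j) ⟩
      ratio j ^ 1 * s 1 ∎)

    q-scale : ∀ n → q j n ≈ ratio j ^ n * q Fin.zero n
    q-scale n = begin
      (const ρ ⊛ (θ (t j) ⊛ D² (t j))) n
        ≈⟨ const-⊛ ρ (θ (t j) ⊛ D² (t j)) n ⟩
      ρ * (θ (t j) ⊛ D² (t j)) n
        ≈⟨ *-congˡ (⊛-cong {θ (t j)} {θ (scale s)} {D² (t j)} {D² (scale s)}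
             (θ-cong t≈scale) (D²-cong t≈scale) n) ⟩
      ρ * (θ (scale s) ⊛ D² (scale s)) n
        ≈⟨ *-congˡ (⊛-cong (θ-scale s) (S.sym scale-D²) n) ⟩
      ρ * (scale (θ s) ⊛ scale (D² s)) n
        ≈⟨ *-congˡ (scale-⊛ (θ s) (D² s) n) ⟨
      ρ * (ratio j ^ n * (θ s ⊛ D² s) n)
        ≈⟨ solve 3 (λ a b c → a :* (b :* c) := b :* (a :* c)) refl ρ (ratio j ^ n) ((θ s ⊛ D² s) n) ⟩
      ratio j ^ n * (ρ * (θ s ⊛ D² s) n)
        ≈⟨ *-congˡ (const-⊛ ρ (θ s ⊛ D² s) n) ⟨
      ratio j ^ n * q Fin.zero n ∎
      where
      D²-cong : ∀ {f g} → f ≈PS g → D² f ≈PS D² g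
      D²-cong f≈g = S.^-congˡ 2 (λ k → +-congˡ (-‿cong (*-congˡ (f≈g k))))
      scale-D² : scale (D² s) ≈PS D² (scale s)
      scale-D² = S.trans (H.^-homo (𝟙 ⊝ (two · s)) 2) (S.^-congˡ 2
        (S.trans (H.minus-homo 𝟙 (two · s)) (S.+-cong scale-1 (S.-‿cong (λ k →
          solve 3 (λ d w x → d :* (w :* x) := w :* (d :* x)) refl (ratio j ^ k) two (s k))))))

  -- By `q-scale` the sum is a common factor times the n-th power sum of the leading coefficients,
  -- which form a full set of r-th roots of unity.
  sum-q-nonmultiple : ∀ n → ¬ (n ℕ.% r ≡ 0) → sumFin q n ≈ 0#
  sum-q-nonmultiple n n%r≢0 = begin
    sumFin q n
      ≈⟨ sumFin-coefficient q n ⟩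
    sum (λ j → q j n)
      ≈⟨ sum-cong-≋ (λ j → begin
           q j n
             ≈⟨ q-scale j n ⟩
           ratio j ^ n * q Fin.zero n
             ≈⟨ *-congʳ (^-distrib-* (leading Fin.zero ^ r′) (leading j) n) ⟩
           b * leading j ^ n * q Fin.zero n
             ≈⟨ solve 3 (λ b y q → b :* y :* q := (b :* q) :* y) refl b (leading j ^ n) (q Fin.zero n) ⟩
           (b * q Fin.zero n) * leading j ^ n ∎) ⟩
    sum (λ j → (b * q Fin.zero n) * leading j ^ n)
      ≈⟨ *-distribˡ-sum (b * q Fin.zero n) (λ j → leading j ^ n) ⟨
    (b * q Fin.zero n) * powerSum leading leading^r leading-injective n
      ≈⟨ *-congˡ (powerSum-vanishes leading leading^r leading-injective n n%r≢0) ⟩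
    (b * q Fin.zero n) * 0#
      ≈⟨ zeroʳ _ ⟩
    0# ∎
    where b = (leading Fin.zero ^ r′) ^ n

  -- Exponent 0 is a multiple of r, yet the generating function starts at k = 1. The right-hand side
  -- agrees because θ kills constant terms.
  sum-q-zero : sumFin q 0 ≈ 0#
  sum-q-zero = begin
    sumFin q 0                    ≈⟨ sumFin-coefficient q 0 ⟩
    sum (λ i → q i 0)             ≈⟨ sum-cong-≋ (λ i → trans (const-⊛ ρ (θ (t i) ⊛ D² (t i)) 0)
                                       (trans (*-congˡ (trans (⊛-zero (θ (t i)) (D² (t i)))
                                         (trans (*-congʳ (zeroˡ _)) (zeroˡ _)))) (zeroʳ _))) ⟩
    sum {r} (λ i → 0#)            ≈⟨ sum-const r 0# ⟩
    natᶜ r * 0#                   ≈⟨ zeroʳ _ ⟩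
    0#                            ∎

  xSer^ : ∀ k → (xSer r ^^ suc k) ≈PS (X S.^ (r ℕ.* suc k))
  xSer^ k = S.trans (^^≈^ (xSer r) (suc k))
    (S.trans (S.^-congˡ (suc k) (^^≈^ X r)) (S.^-assocʳ X r (suc k)))

  term-zero : ∀ n k → ¬ (n ≡ r ℕ.* suc k) → φ (tr (suc k) r) * (xSer r ^^ suc k) n ≈ 0#
  term-zero n k n≢ =
    trans (*-congˡ (trans (xSer^ k n) (X^-other (r ℕ.* suc k) n n≢))) (zeroʳ _)

  trGF-multiple : ∀ k → trGF K φ r (r ℕ.* suc k) ≈ - φ ½ * G k (r ℕ.* suc k ∸ 1)
  trGF-multiple k = begin
    trGF K φ r N
      -- The cutoff of the sum at N keeps the term k because k + 1 ≤ r (k + 1), and cancelling r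
      -- shows that no other power of x reaches degree N.
      ≈⟨ sumUpTo-only N k (ℕ.m≤n*m (suc k) r) (λ i i≢k → term-zero N i
           (λ eq → i≢k (≡.sym (ℕ.suc-injective (ℕ.*-cancelˡ-≡ (suc k) (suc i) r eq))))) ⟩
    φ (tr (suc k) r) * (xSer r ^^ suc k) N
      ≈⟨ *-congˡ (trans (xSer^ k N) (X^-same N)) ⟩
    φ (tr (suc k) r) * 1#
      ≈⟨ *-identityʳ _ ⟩
    φ (ℚ.- (½ ℚ.* g))
      ≈⟨ -‿homo (½ ℚ.* g) ⟩
    - φ (½ ℚ.* g)
      ≈⟨ -‿cong (*-homo ½ g) ⟩
    - (φ ½ * φ g)
      ≈⟨ solve 2 (λ a b → :- (a :* b) := (:- a) :* b) refl (φ ½) (φ g) ⟩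
    - φ ½ * φ g ∎
    where
    N = r ℕ.* suc k
    g = trIntegrand (suc k) r (N ∸ 1)

  trGF-nonmultiple : ∀ n → ¬ (n ℕ.% r ≡ 0) → trGF K φ r n ≈ 0#
  trGF-nonmultiple n n%r≢0 = sumUpTo-zero n (λ k _ → term-zero n k (λ eq → n%r≢0
    (≡.trans (≡.cong (ℕ._% r) (≡.trans eq (ℕ.*-comm r (suc k)))) (ℕ.m*n%n≡0 (suc k) r))))

  multiple : ∀ a → trGF K φ r (r ℕ.* a) ≈ - φ ½ * sumFin q (r ℕ.* a)
  multiple zero rewrite ℕ.*-zeroʳ r′ = sym (trans (*-congˡ sum-q-zero) (zeroʳ _))
  multiple (suc k) = trans (trGF-multiple k) (*-congˡ (sym (sum-q-multiple k)))

  generatingFunction : trGF K φ r ≈PS ((- φ ½) · sumFin q)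
  generatingFunction n with n ℕ.% r ℕ.≟ 0
  ... | no n%r≢0 = trans (trGF-nonmultiple n n%r≢0)
                         (sym (trans (*-congˡ (sum-q-nonmultiple n n%r≢0)) (zeroʳ _)))
  ... | yes n%r≡0 = ≡.subst (λ m → trGF K φ r m ≈ - φ ½ * sumFin q m) n≡ (multiple (n ℕ./ r))
    where
    n≡ : r ℕ.* (n ℕ./ r) ≡ n
    n≡ = ≡.trans (ℕ.*-comm r (n ℕ./ r))
      (≡.sym (≡.trans (ℕ.m≡m%n+[m/n]*n n r) (≡.cong (ℕ._+ n ℕ./ r ℕ.* r) n%r≡0)))

theorem3p1 : ∀ {c ℓ : Level} (K : CommutativeRing c ℓ) →
    let open CommutativeRing K
        open PowerSeries K
    in (φ : ℚ → Carrier) →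
       IsRingHomomorphism (CommutativeRing.rawRing ℚring) rawRing φ →
       ¬ (1# ≈ 0#) →
       (∀ a b → a * b ≈ 0# → (a ≈ 0#) ⊎ (b ≈ 0#)) →
       (r : ℕ) → 2 ≤ r →
       (t : Fin r → PS) →
       (∀ i → IsSmallZero r (t i)) →
       (∀ i j → t i ≈PS t j → i ≡ j) →
       Σ (Fin r → PS) (λ q →
         (∀ i → (q i ⊛ evalP (derivP (Ppoly r (xSer r))) (t i)) ≈PS numer r (t i))
         × (trGF K φ r ≈PS ((- (φ ½)) · sumFin q)))
theorem3p1 K φ hom _ zero-product (suc r′) _ t zeros distinct = q , q-quotient , generatingFunction
  where open ResidueSum K φ hom zero-product r′ t zeros distinct
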